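{- Consider the following equations in the unary symbol $\neg$, the binary symbols $\wedge,\vee$ and (where they occur) the constants $\mathsf T,\mathsf F,\mathsf U$: (Neg) $\mathsf F=\neg\mathsf T$; (Or) $x\vee y=\neg(\neg x\wedge\neg y)$; (Tand) $\mathsf T\wedge x=x$; (Abs) $x\wedge(x\vee y)=x$; (Mem) $(x\vee y)\wedge z=(\neg x\wedge(y\wedge z))\vee(x\wedge z)$; (Com) $(x\wedge y)\vee(y\wedge x)=(y\wedge x)\vee(x\wedge y)$; (Und) $\neg\mathsf U=\mathsf U$. Then: (i) $\mathrm{CL}$ (no constants distinguished) is completely axiomatised by the five axioms $\neg\neg x=x$, (Or), (Abs), (Mem), (Com), and these axioms are independent. (ii) $\mathrm{CL}_2$ ($\mathsf T$ and $\mathsf F$ distinguished) is completely axiomatised by the six axioms (Neg), (Or), (Tand), (Abs), (Mem), (Com), and these axioms are independent. (iii) $\mathrm{CL}^{\mathsf U}$ (only $\mathsf U$ distinguished) is completely axiomatised by the six axioms $\neg\neg x=x$, $\neg\mathsf U=\mathsf U$, (Or), (Abs), (Mem), (Com), and these axioms are independent. (iv) $\mathrm{CL}_3$ (all constants distinguished) is completely axiomatised by the seven axioms (Neg), (Or), (Tand), (Abs), (Mem), (Com), (Und), and these axioms are independent.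
   Context: $\mathrm{CL}$ (conditional logic of Guzmán and Squier) is the equational theory over the signature $\{\neg,\wedge,\vee\}$ axiomatised by $\neg\neg x=x$; $\neg(x\wedge y)=\neg x\vee\neg y$; $(x\wedge y)\wedge z=x\wedge(y\wedge z)$; $x\wedge(y\vee z)=(x\wedge y)\vee(x\wedge z)$; $(x\vee y)\wedge z=(x\wedge z)\vee(\neg x\wedge y\wedge z)$ (bracketing immaterial by associativity); $x\vee(x\wedge y)=x$; $(x\wedge y)\vee(y\wedge x)=(y\wedge x)\vee(x\wedge y)$. $\mathrm{CL}_2$ is $\mathrm{CL}$ with constants $\mathsf T,\mathsf F$ and the extra axioms $\mathsf T\wedge x=x$, $\neg\mathsf T=\mathsf F$. $\mathrm{CL}^{\mathsf U}$ is $\mathrm{CL}$ with constant $\mathsf U$ and the extra axiom $\neg\mathsf U=\mathsf U$. $\mathrm{CL}_3$ is $\mathrm{CL}$ with constants $\mathsf T,\mathsf F,\mathsf U$ and the three extra axioms $\mathsf T\wedge x=x$, $\neg\mathsf T=\mathsf F$, $\neg\mathsf U=\mathsf U$. A set $E$ of equations completely axiomatises one of these logics if, over the corresponding signature, exactly the equations of that logic (i.e. the equational consequences of its axioms just listed) are derivable from $E$ in equational logic. (By a theorem of Guzmán and Squier these are exactly the equations valid in the algebra $C=\{\mathsf T,\mathsf F,\mathsf U\}$ with $\neg\mathsf T=\mathsf F$, $\neg\mathsf F=\mathsf T$, $\neg\mathsf U=\mathsf U$; $\mathsf T\wedge y=y$, $\mathsf F\wedge y=\mathsf F$, $\mathsf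 U\wedge y=\mathsf U$; $\mathsf T\vee y=\mathsf T$, $\mathsf F\vee y=y$, $\mathsf U\vee y=\mathsf U$, with the relevant constants distinguished.) A group of axioms is independent if no axiom in it is derivable (in equational logic) from the other axioms of the group. -}

module Defs where

open import Data.Bool.Base using (Bool; true; false)
open import Data.Fin.Base using (Fin)
open import Data.List.Base using (List; []; _∷_; _++_; length; lookup; removeAt)
open import Data.List.Membership.Propositional using (_∈_)
open import Data.Nat.Base using (ℕ)
open import Function.Bundles using (_⇔_)
open import Relation.Nullary.Negation using () renaming (¬_ to not_)

infix  9 ¬_
infixr 8 _∧_
infixr 7 _∨_
infix  6 _≈_
infix  3 _⊢_

-- The first index says whether T and F are distinguished, the second whether
-- U is.
data Constant : (tf u : Bool) → Set where
  T F : ∀ {u}  → Constant true u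
  U   : ∀ {tf} → Constant tf true

data Term (K : Set) : Set where
  var     : ℕ → Term K
  const   : K → Term K
  ¬_      : Term K → Term K
  _∧_ _∨_ : Term K → Term K → Term K

record Equation (K : Set) : Set where
  constructor _≈_
  field
    lhs rhs : Term K

_[_] : ∀ {K} → Term K → (ℕ → Term K) → Term K
var n   [ σ ] = σ n
const k [ σ ] = const k
(¬ s)   [ σ ] = ¬ (s [ σ ])
(s ∧ t) [ σ ] = (s [ σ ]) ∧ (t [ σ ])
(s ∨ t) [ σ ] = (s [ σ ]) ∨ (t [ σ ])

data _⊢_ {K : Set} (E : List (Equation K)) : Equation K → Set where
  axiom  : ∀ {s t} → (s ≈ t) ∈ E → ∀ σ → E ⊢ s [ σ ] ≈ t [ σ ]
  refl   : ∀ {s} → E ⊢ s ≈ s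
  sym    : ∀ {s t} → E ⊢ s ≈ t → E ⊢ t ≈ s
  trans  : ∀ {s t r} → E ⊢ s ≈ t → E ⊢ t ≈ r → E ⊢ s ≈ r
  ¬-cong : ∀ {s s′} → E ⊢ s ≈ s′ → E ⊢ ¬ s ≈ ¬ s′
  ∧-cong : ∀ {s s′ t t′} → E ⊢ s ≈ s′ → E ⊢ t ≈ t′ → E ⊢ s ∧ t ≈ s′ ∧ t′
  ∨-cong : ∀ {s s′ t t′} → E ⊢ s ≈ s′ → E ⊢ t ≈ t′ → E ⊢ s ∨ t ≈ s′ ∨ t′

_CompletelyAxiomatises_ : ∀ {K} → List (Equation K) → List (Equation K) → Set
E CompletelyAxiomatises L = ∀ e → (E ⊢ e) ⇔ (L ⊢ e)

Independent : ∀ {K} → List (Equation K) → Set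
Independent E = (i : Fin (length E)) → not (removeAt E i ⊢ lookup E i)

private
  x y z : ∀ {K} → Term K
  x = var 0
  y = var 1
  z = var 2

CL : ∀ {K} → List (Equation K)
CL = ¬ (¬ x)      ≈ x
   ∷ ¬ (x ∧ y)    ≈ (¬ x) ∨ (¬ y)
   ∷ (x ∧ y) ∧ z  ≈ x ∧ (y ∧ z)
   ∷ x ∧ (y ∨ z)  ≈ (x ∧ y) ∨ (x ∧ z)
   ∷ (x ∨ y) ∧ z  ≈ (x ∧ z) ∨ ((¬ x) ∧ (y ∧ z))
   ∷ x ∨ (x ∧ y)  ≈ x
   ∷ (x ∧ y) ∨ (y ∧ x) ≈ (y ∧ x) ∨ (x ∧ y)
   ∷ []

CL₀ : List (Equation (Constant false false))
CL₀ = CL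

CL₂ : List (Equation (Constant true false))
CL₂ = CL ++ const T ∧ x ≈ x
          ∷ ¬ const T   ≈ const F
          ∷ []

CLᵁ : List (Equation (Constant false true))
CLᵁ = CL ++ ¬ const U ≈ const U
          ∷ []

CL₃ : List (Equation (Constant true true))
CL₃ = CL ++ const T ∧ x ≈ x
          ∷ ¬ const T   ≈ const F
          ∷ ¬ const U   ≈ const U
          ∷ []

Neg Tand : ∀ {u} → Equation (Constant true u)
Neg  = const F ≈ ¬ const T
Tand = const T ∧ x ≈ x

Und : ∀ {tf} → Equation (Constant tf true)
Und = ¬ const U ≈ const U

DNeg Or Abs Mem Com : ∀ {K} → Equation K
DNeg = ¬ (¬ x) ≈ x
Or   = x ∨ y ≈ ¬ ((¬ x) ∧ (¬ y))
Abs  = x ∧ (x ∨ y) ≈ x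
Mem  = (x ∨ y) ∧ z ≈ ((¬ x) ∧ (y ∧ z)) ∨ (x ∧ z)
Com  = (x ∧ y) ∨ (y ∧ x) ≈ (y ∧ x) ∨ (x ∧ y)

Ax₀ : List (Equation (Constant false false))
Ax₀ = DNeg ∷ Or ∷ Abs ∷ Mem ∷ Com ∷ []

Ax₂ : List (Equation (Constant true false))
Ax₂ = Neg ∷ Or ∷ Tand ∷ Abs ∷ Mem ∷ Com ∷ []

Axᵁ : List (Equation (Constant false true))
Axᵁ = DNeg ∷ Und ∷ Or ∷ Abs ∷ Mem ∷ Com ∷ []

Ax₃ : List (Equation (Constant true true))
Ax₃ = Neg ∷ Or ∷ Tand ∷ Abs ∷ Mem ∷ Com ∷ Und ∷ []

{-# OPTIONS --safe #-}

-- The delicate direction is from the short axiomatisations to CL. Modulo double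
-- negation and De Morgan, Abs and Mem yield x ∧ ((x ∨ y) ∧ z) ≈ x ∧ z. Hence an
-- initial x acts as a context in which x is true: x ∧ (y ∨ (¬ x ∧ z)) ≈ x ∧ y
-- and x ∧ ((¬ x ∧ y) ∨ z) ≈ x ∧ z. This gives associativity and left
-- distributivity, and it shows that the branches of (x ∧ y) ∨ (¬ x ∧ z) commute,
-- since both orders equal (x ∨ ¬ x) ∧ ((x ∧ y) ∨ (¬ x ∧ z)). Commuting branches
-- also turn Mem into the right distributivity of CL and back. Com is only carried
-- along here; in CL it gives x ∧ ¬ x ≈ ¬ x ∧ x and x ∨ (y ∨ x) ≈ x ∨ y.
-- Independence is witnessed by algebras with at most four elements.
module Submission where

open import Data.Bool.Base using (Bool; true)
open import Data.Fin.Base using (Fin)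
open import Data.Fin.Patterns using (0F; 1F; 2F; 3F)
open import Data.Fin.Properties using (all?; _≟_)
open import Data.List.Base using (List; []; _∷_; length; lookup; removeAt)
open import Data.List.Relation.Unary.All as All using (All; []; _∷_)
open import Data.List.Relation.Unary.All.Properties using (++⁻ˡ; ++⁻ʳ; ++⁺)
open import Data.List.Relation.Unary.Any using (here; there)
open import Data.Nat.Base using (ℕ; suc; s≤s; _<_)
open import Data.Nat.Properties using (_<?_)
open import Data.Product.Base using (_×_; _,_)
open import Data.Unit.Base using (⊤; tt)
open import Data.Vec.Base as Vec using (Vec; []; _∷_)
open import Function.Bundles using (mk⇔)
open import Relation.Nullary.Decidable using (Dec; yes; ¬?; _×-dec_; True; toWitness)
open import Relation.Nullary.Negation using () renaming (¬_ to not_)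
open import Relation.Binary.Bundles using (Setoid)
import Relation.Binary.Reasoning.Setoid as SetoidReasoning
open import Relation.Binary.PropositionalEquality as ≡ using (_≡_)
open import Defs

infix 3 _⊩_

-- A derived equation is kept together with all its substitution instances, so that it can stand in
-- for an axiom inside a derivation.
_⊩_ : ∀ {K} → List (Equation K) → Equation K → Set
E ⊩ (s ≈ t) = ∀ σ → E ⊢ s [ σ ] ≈ t [ σ ]

-- The equations mention only the variables 0, 1 and 2, so `t` serves as variable 2 and as the
-- default for every later index.
assign : {A : Set} → A → A → A → ℕ → A
assign r s t 0 = r
assign r s t 1 = s
assign r s t _ = t

Ax : ∀ {K} → List (Equation K)
Ax = DNeg ∷ Or ∷ Abs ∷ Mem ∷ Com ∷ []

-- Terms as an algebra with a strict involution.

module Involution {K : Set} (E : List (Equation K)) (dneg : E ⊩ DNeg) (or : E ⊩ Or) where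

  -- A term paired with a negation of it. Negation swaps the components, so that
  -- double negation and the De Morgan laws hold definitionally, and the dual of a
  -- lemma is obtained from it by ∼-cong.
  record Element : Set where
    constructor element
    field
      pos neg : Term K
      pos≈¬neg : E ⊢ pos ≈ ¬ neg
      neg≈¬pos : E ⊢ neg ≈ ¬ pos
  open Element public

  infix  9 ∼_
  infixr 8 _⊓_
  infixr 7 _⊔_
  infix  4 _≋_

  -- Comparing `pos` suffices, since each `neg` is provably the negation of its `pos`. The record
  -- wrapper lets the two elements be recovered from the type.
  record _≋_ (x y : Element) : Set where
    constructor lift
    field lower : E ⊢ pos x ≈ pos y
  open _≋_ public

  embed : Term K → Element
  embed s = element s (¬ s) (sym (dneg (λ _ → s))) refl

  ∼_ : Element → Element
  ∼ element p n p≈¬n n≈¬p = element n p n≈¬p p≈¬n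

  -- Left to unfold, these would make the arguments of _⊓_ uninferable.
  abstract
    join≈¬meet : ∀ x y → E ⊢ neg x ∨ neg y ≈ ¬ (pos x ∧ pos y)
    join≈¬meet x y = trans (or (assign (neg x) (neg y) (neg y)))
      (¬-cong (∧-cong (sym (pos≈¬neg x)) (sym (pos≈¬neg y))))

    meet≈¬join : ∀ x y → E ⊢ pos x ∧ pos y ≈ ¬ (neg x ∨ neg y)
    meet≈¬join x y = trans (sym (dneg (λ _ → pos x ∧ pos y))) (¬-cong (sym (join≈¬meet x y)))

  -- The second component of a meet is the syntactic disjunction of the negations, so `pos (x ⊔ y)`
  -- reduces to `pos x ∨ pos y`.
  _⊓_ _⊔_ : Element → Element → Element
  x ⊓ y = element (pos x ∧ pos y) (neg x ∨ neg y) (meet≈¬join x y) (join≈¬meet x y)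
  x ⊔ y = ∼ (∼ x ⊓ ∼ y)

  setoid : Setoid _ _
  setoid = record
    { Carrier       = Element
    ; _≈_           = _≋_
    ; isEquivalence = record
      { refl  = lift refl
      ; sym   = λ (lift p) → lift (sym p)
      ; trans = λ (lift p) (lift q) → lift (trans p q)
      }
    }

  ∼-cong : ∀ {x y} → x ≋ y → ∼ x ≋ ∼ y
  ∼-cong {x} {y} (lift p) = lift (trans (neg≈¬pos x) (trans (¬-cong p) (sym (neg≈¬pos y))))

  ⊓-congˡ : ∀ {x y z} → y ≋ z → x ⊓ y ≋ x ⊓ z
  ⊓-congˡ (lift p) = lift (∧-cong refl p)

  ⊓-congʳ : ∀ {x y z} → y ≋ z → y ⊓ x ≋ z ⊓ x
  ⊓-congʳ (lift p) = lift (∧-cong p refl)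

  ⊔-congˡ : ∀ {x y z} → y ≋ z → x ⊔ y ≋ x ⊔ z
  ⊔-congˡ (lift p) = lift (∨-cong refl p)

  ⊔-congʳ : ∀ {x y z} → y ≋ z → y ⊔ x ≋ z ⊔ x
  ⊔-congʳ (lift p) = lift (∨-cong p refl)

  -- Both axiom systems prove these hypotheses, so the commutation of branches is derived once and
  -- used in either direction.
  module Branches
    (excluded-middle-comm : ∀ x → x ⊔ ∼ x ≋ ∼ x ⊔ x)
    (split : ∀ x y → (x ⊔ ∼ x) ⊓ y ≋ (x ⊓ y) ⊔ (∼ x ⊓ y))
    (select-true : ∀ x y z → x ⊓ (y ⊔ (∼ x ⊓ z)) ≋ x ⊓ y)
    (select-false : ∀ x y z → x ⊓ ((∼ x ⊓ y) ⊔ z) ≋ x ⊓ z)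
    (⊓-⊓ : ∀ x y → x ⊓ (x ⊓ y) ≋ x ⊓ y) where

    open SetoidReasoning setoid

    -- Both sides are (x ⊔ ∼ x) ⊓ w, where w is the left-hand side.
    branches-comm : ∀ x y z → (x ⊓ y) ⊔ (∼ x ⊓ z) ≋ (∼ x ⊓ z) ⊔ (x ⊓ y)
    branches-comm x y z = begin
      (x ⊓ y) ⊔ (∼ x ⊓ z)         ≈⟨ ⊔-congʳ true-branch ⟨
      (x ⊓ w) ⊔ (∼ x ⊓ z)         ≈⟨ ⊔-congˡ false-branch ⟨
      (x ⊓ w) ⊔ (∼ x ⊓ w)         ≈⟨ split x w ⟨
      (x ⊔ ∼ x) ⊓ w               ≈⟨ ⊓-congʳ (excluded-middle-comm x) ⟩
      (∼ x ⊔ x) ⊓ w               ≈⟨ split (∼ x) w ⟩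
      (∼ x ⊓ w) ⊔ (x ⊓ w)         ≈⟨ ⊔-congʳ false-branch ⟩
      (∼ x ⊓ z) ⊔ (x ⊓ w)         ≈⟨ ⊔-congˡ true-branch ⟩
      (∼ x ⊓ z) ⊔ (x ⊓ y)         ∎
      where
      w = (x ⊓ y) ⊔ (∼ x ⊓ z)

      true-branch : x ⊓ w ≋ x ⊓ y
      true-branch = begin
        x ⊓ w               ≈⟨ select-true x (x ⊓ y) z ⟩
        x ⊓ (x ⊓ y)         ≈⟨ ⊓-⊓ x y ⟩
        x ⊓ y               ∎

      false-branch : ∼ x ⊓ w ≋ ∼ x ⊓ z
      false-branch = begin
        -- `∼ ∼ x` reduces to `x`, so `x ⊓ y` is the disjunct that `∼ x` rules out.
        ∼ x ⊓ w             ≈⟨ select-false (∼ x) y (∼ x ⊓ z) ⟩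
        ∼ x ⊓ (∼ x ⊓ z)     ≈⟨ ⊓-⊓ (∼ x) z ⟩
        ∼ x ⊓ z             ∎

-- From the short axioms to conditional logic.

module Memorising {K : Set} (E : List (Equation K))
  (dneg : E ⊩ DNeg) (or : E ⊩ Or) (abs : E ⊩ Abs) (mem : E ⊩ Mem) where

  open Involution E dneg or
  open SetoidReasoning setoid
  open Setoid setoid using () renaming (sym to ≋-sym; trans to ≋-trans)

  ⊓-abs : ∀ x y → x ⊓ (x ⊔ y) ≋ x
  ⊓-abs x y = lift (abs (assign (pos x) (pos y) (pos y)))

  ⊔-abs : ∀ x y → x ⊔ (x ⊓ y) ≋ x
  ⊔-abs x y = ∼-cong (⊓-abs (∼ x) (∼ y))

  ⊓-mem : ∀ x y z → (x ⊔ y) ⊓ z ≋ (∼ x ⊓ (y ⊓ z)) ⊔ (x ⊓ z)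
  ⊓-mem x y z = lift (trans (mem (assign (pos x) (pos y) (pos z)))
    (∨-cong (∧-cong (sym (neg≈¬pos x)) refl) refl))

  ⊔-mem : ∀ x y z → (x ⊓ y) ⊔ z ≋ (∼ x ⊔ (y ⊔ z)) ⊓ (x ⊔ z)
  ⊔-mem x y z = ∼-cong (⊓-mem (∼ x) (∼ y) (∼ z))

  ⊓-idem : ∀ x → x ⊓ x ≋ x
  ⊓-idem x = begin
    x ⊓ x              ≈⟨ ⊓-congˡ (⊔-abs x x) ⟨
    x ⊓ (x ⊔ (x ⊓ x))  ≈⟨ ⊓-abs x (x ⊓ x) ⟩
    x                  ∎

  ⊔-idem : ∀ x → x ⊔ x ≋ x
  ⊔-idem x = ∼-cong (⊓-idem (∼ x))

  ⊓-mem-self : ∀ x y → (x ⊔ y) ⊓ y ≋ (∼ x ⊓ y) ⊔ (x ⊓ y)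
  ⊓-mem-self x y = begin
    (x ⊔ y) ⊓ y                   ≈⟨ ⊓-mem x y y ⟩
    (∼ x ⊓ (y ⊓ y)) ⊔ (x ⊓ y)     ≈⟨ ⊔-congʳ (⊓-congˡ (⊓-idem y)) ⟩
    (∼ x ⊓ y) ⊔ (x ⊓ y)           ∎

  -- Since the last factor is itself a join headed by `x`, absorption collapses the second branch of
  -- Mem.
  ⊓-mem-⊔ˡ : ∀ x y z → (x ⊔ y) ⊓ (x ⊔ z) ≋ (∼ x ⊓ (y ⊓ (x ⊔ z))) ⊔ x
  ⊓-mem-⊔ˡ x y z = begin
    (x ⊔ y) ⊓ (x ⊔ z)                             ≈⟨ ⊓-mem x y (x ⊔ z) ⟩
    (∼ x ⊓ (y ⊓ (x ⊔ z))) ⊔ (x ⊓ (x ⊔ z))         ≈⟨ ⊔-congˡ (⊓-abs x z) ⟩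
    (∼ x ⊓ (y ⊓ (x ⊔ z))) ⊔ x                     ∎

  ⊓-mem-⊔ʳ : ∀ x y z → (x ⊔ y) ⊓ (y ⊔ z) ≋ (∼ x ⊓ y) ⊔ (x ⊓ (y ⊔ z))
  ⊓-mem-⊔ʳ x y z = begin
    (x ⊔ y) ⊓ (y ⊔ z)                             ≈⟨ ⊓-mem x y (y ⊔ z) ⟩
    (∼ x ⊓ (y ⊓ (y ⊔ z))) ⊔ (x ⊓ (y ⊔ z))         ≈⟨ ⊔-congʳ (⊓-congˡ (⊓-abs y z)) ⟩
    (∼ x ⊓ y) ⊔ (x ⊓ (y ⊔ z))                     ∎

  excluded-middle-⊓ : ∀ x → (x ⊔ ∼ x) ⊓ ∼ x ≋ ∼ x ⊔ (x ⊓ ∼ x)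
  excluded-middle-⊓ x = begin
    (x ⊔ ∼ x) ⊓ ∼ x               ≈⟨ ⊓-mem-self x (∼ x) ⟩
    (∼ x ⊓ ∼ x) ⊔ (x ⊓ ∼ x)       ≈⟨ ⊔-congʳ (⊓-idem (∼ x)) ⟩
    ∼ x ⊔ (x ⊓ ∼ x)               ∎

  -- Dualising `excluded-middle-⊓` gives `(∼ x ⊓ x) ⊔ x`, which up to idempotence is Mem with all
  -- three variables equal to `x`.
  ⊓-excluded-middle : ∀ x → x ⊓ (∼ x ⊔ x) ≋ x
  ⊓-excluded-middle x = begin
    x ⊓ (∼ x ⊔ x)             ≈⟨ ∼-cong (excluded-middle-⊓ x) ⟨
    (∼ x ⊓ x) ⊔ x             ≈⟨ ⊔-congˡ (⊓-idem x) ⟨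
    (∼ x ⊓ x) ⊔ (x ⊓ x)       ≈⟨ ⊓-mem-self x x ⟨
    (x ⊔ x) ⊓ x               ≈⟨ ⊓-congʳ (⊔-idem x) ⟩
    x ⊓ x                     ≈⟨ ⊓-idem x ⟩
    x                         ∎

  -- Squaring `x ⊔ ∼ x` and expanding by Mem puts the branch guarded by `∼ x` first.
  excluded-middle-comm : ∀ x → x ⊔ ∼ x ≋ ∼ x ⊔ x
  excluded-middle-comm x = begin
    x ⊔ ∼ x                                   ≈⟨ ⊓-idem (x ⊔ ∼ x) ⟨
    (x ⊔ ∼ x) ⊓ (x ⊔ ∼ x)                     ≈⟨ ⊓-mem-⊔ˡ x (∼ x) (∼ x) ⟩
    (∼ x ⊓ (∼ x ⊓ (x ⊔ ∼ x))) ⊔ x             ≈⟨ ⊔-congʳ (⊓-congˡ (⊓-excluded-middle (∼ x))) ⟩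
    (∼ x ⊓ ∼ x) ⊔ x                           ≈⟨ ⊔-congʳ (⊓-idem (∼ x)) ⟩
    ∼ x ⊔ x                                   ∎

  contradiction-comm : ∀ x → x ⊓ ∼ x ≋ ∼ x ⊓ x
  contradiction-comm x = ∼-cong (excluded-middle-comm (∼ x))

  excluded-middle-identityˡ : ∀ x → (x ⊔ ∼ x) ⊓ x ≋ x
  excluded-middle-identityˡ x = begin
    (x ⊔ ∼ x) ⊓ x         ≈⟨ ⊓-congʳ (excluded-middle-comm x) ⟩
    (∼ x ⊔ x) ⊓ x         ≈⟨ excluded-middle-⊓ (∼ x) ⟩
    x ⊔ (∼ x ⊓ x)         ≈⟨ ∼-cong (⊓-excluded-middle (∼ x)) ⟩
    x                     ∎

  -- In a join the second argument matters only when `x` is false, so a guard `∼ x` is harmless. The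
  -- dual of Mem on `(x ⊓ x) ⊔ y`, followed by Mem, introduces it.
  ⊔-remember : ∀ x y → x ⊔ (∼ x ⊓ (x ⊔ y)) ≋ x ⊔ y
  ⊔-remember x y = begin
    x ⊔ (∼ x ⊓ (x ⊔ y))                       ≈⟨ ⊔-congʳ (⊓-abs x y) ⟨
    (x ⊓ (x ⊔ y)) ⊔ (∼ x ⊓ (x ⊔ y))           ≈⟨ ⊓-mem-self (∼ x) (x ⊔ y) ⟨
    (∼ x ⊔ (x ⊔ y)) ⊓ (x ⊔ y)                 ≈⟨ ⊔-mem x x y ⟨
    (x ⊓ x) ⊔ y                               ≈⟨ ⊔-congʳ (⊓-idem x) ⟩
    x ⊔ y                                     ∎

  ⊓-remember : ∀ x y → x ⊓ (∼ x ⊔ (x ⊓ y)) ≋ x ⊓ y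
  ⊓-remember x y = ∼-cong (⊔-remember (∼ x) (∼ y))

  excluded-middle-⊓-⊔ : ∀ x y → (x ⊔ ∼ x) ⊓ (x ⊔ y) ≋ x ⊔ (∼ x ⊓ (x ⊔ y))
  excluded-middle-⊓-⊔ x y = begin
    (x ⊔ ∼ x) ⊓ (x ⊔ y)                       ≈⟨ ⊓-congʳ (excluded-middle-comm x) ⟩
    (∼ x ⊔ x) ⊓ (x ⊔ y)                       ≈⟨ ⊓-mem-⊔ʳ (∼ x) x y ⟩
    (x ⊓ x) ⊔ (∼ x ⊓ (x ⊔ y))                 ≈⟨ ⊔-congʳ (⊓-idem x) ⟩
    x ⊔ (∼ x ⊓ (x ⊔ y))                       ∎

  excluded-middle-⊔-identity : ∀ x y → (x ⊔ ∼ x) ⊓ (x ⊔ y) ≋ x ⊔ y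
  excluded-middle-⊔-identity x y = ≋-trans (excluded-middle-⊓-⊔ x y) (⊔-remember x y)

  ⊓-excluded-middle-⊓-⊔ : ∀ x y → x ⊓ ((∼ x ⊔ x) ⊓ (x ⊔ y)) ≋ x
  ⊓-excluded-middle-⊓-⊔ x y = begin
    x ⊓ ((∼ x ⊔ x) ⊓ (x ⊔ y))                     ≈⟨ ⊓-congˡ (⊓-mem-⊔ʳ (∼ x) x y) ⟩
    x ⊓ ((x ⊓ x) ⊔ (∼ x ⊓ (x ⊔ y)))               ≈⟨ ⊓-congʳ (⊓-idem x) ⟨
    (x ⊓ x) ⊓ ((x ⊓ x) ⊔ (∼ x ⊓ (x ⊔ y)))         ≈⟨ ⊓-abs (x ⊓ x) (∼ x ⊓ (x ⊔ y)) ⟩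
    x ⊓ x                                         ≈⟨ ⊓-idem x ⟩
    x                                             ∎

  -- The join added by absorption is an instance of the right-hand side of Mem and folds back to
  -- `∼ x ⊓ x`. The dual of this lopsided form feeds `⊔-excluded-middle`.
  ⊓-contradiction : ∀ x → x ⊓ (∼ x ⊓ x) ≋ (x ⊓ (x ⊓ ∼ x)) ⊓ (∼ x ⊓ x)
  ⊓-contradiction x = begin
    x ⊓ (∼ x ⊓ x)                                             ≈⟨ ⊓-abs (x ⊓ (∼ x ⊓ x)) (∼ x ⊓ x) ⟨
    (x ⊓ (∼ x ⊓ x)) ⊓ ((x ⊓ (∼ x ⊓ x)) ⊔ (∼ x ⊓ x))           ≈⟨ ⊓-congˡ (⊓-mem (∼ x) (∼ x) x) ⟨
    (x ⊓ (∼ x ⊓ x)) ⊓ ((∼ x ⊔ ∼ x) ⊓ x)                       ≈⟨ ⊓-congˡ (⊓-congʳ (⊔-idem (∼ x))) ⟩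
    (x ⊓ (∼ x ⊓ x)) ⊓ (∼ x ⊓ x)                               ≈⟨ ⊓-congʳ (⊓-congˡ (contradiction-comm x)) ⟨
    (x ⊓ (x ⊓ ∼ x)) ⊓ (∼ x ⊓ x)                               ∎

  -- Mem carries the final `y` into the join, where it swallows `y ⊔ ∼ y`. The next lemma repeats
  -- this one level deeper.
  ⊔-excluded-middle-⊓ : ∀ x y → (x ⊔ (y ⊔ ∼ y)) ⊓ y ≋ (x ⊔ y) ⊓ y
  ⊔-excluded-middle-⊓ x y = begin
    (x ⊔ (y ⊔ ∼ y)) ⊓ y                       ≈⟨ ⊓-mem x (y ⊔ ∼ y) y ⟩
    (∼ x ⊓ ((y ⊔ ∼ y) ⊓ y)) ⊔ (x ⊓ y)         ≈⟨ ⊔-congʳ (⊓-congˡ (excluded-middle-identityˡ y)) ⟩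
    (∼ x ⊓ y) ⊔ (x ⊓ y)                       ≈⟨ ⊓-mem-self x y ⟨
    (x ⊔ y) ⊓ y                               ∎

  ⊔-⊔-excluded-middle-⊓ : ∀ x y z → (x ⊔ (y ⊔ (z ⊔ ∼ z))) ⊓ z ≋ (x ⊔ (y ⊔ z)) ⊓ z
  ⊔-⊔-excluded-middle-⊓ x y z = begin
    (x ⊔ (y ⊔ (z ⊔ ∼ z))) ⊓ z                         ≈⟨ ⊓-mem x (y ⊔ (z ⊔ ∼ z)) z ⟩
    (∼ x ⊓ ((y ⊔ (z ⊔ ∼ z)) ⊓ z)) ⊔ (x ⊓ z)           ≈⟨ ⊔-congʳ (⊓-congˡ (⊔-excluded-middle-⊓ y z)) ⟩
    (∼ x ⊓ ((y ⊔ z) ⊓ z)) ⊔ (x ⊓ z)                   ≈⟨ ⊓-mem x (y ⊔ z) z ⟨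
    (x ⊔ (y ⊔ z)) ⊓ z                                 ∎

  ⊔-⊔-⊓-⊔ : ∀ x y → (x ⊔ (x ⊔ y)) ⊓ (x ⊔ y) ≋ (∼ x ⊓ (x ⊔ y)) ⊔ x
  ⊔-⊔-⊓-⊔ x y = begin
    (x ⊔ (x ⊔ y)) ⊓ (x ⊔ y)                       ≈⟨ ⊓-mem-⊔ˡ x (x ⊔ y) y ⟩
    (∼ x ⊓ ((x ⊔ y) ⊓ (x ⊔ y))) ⊔ x               ≈⟨ ⊔-congʳ (⊓-congˡ (⊓-idem (x ⊔ y))) ⟩
    (∼ x ⊓ (x ⊔ y)) ⊔ x                           ∎

  ⊔-excluded-middle-identityˡ : ∀ x y → (x ⊔ (x ⊔ ∼ x)) ⊓ (∼ x ⊔ y) ≋ ∼ x ⊔ y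
  ⊔-excluded-middle-identityˡ x y = begin
    (x ⊔ (x ⊔ ∼ x)) ⊓ (∼ x ⊔ y)                                   ≈⟨ ⊓-mem x (x ⊔ ∼ x) (∼ x ⊔ y) ⟩
    (∼ x ⊓ ((x ⊔ ∼ x) ⊓ (∼ x ⊔ y))) ⊔ (x ⊓ (∼ x ⊔ y))             ≈⟨ ⊔-congʳ (⊓-excluded-middle-⊓-⊔ (∼ x) y) ⟩
    ∼ x ⊔ (x ⊓ (∼ x ⊔ y))                                         ≈⟨ ⊔-remember (∼ x) y ⟩
    ∼ x ⊔ y                                                       ∎

  -- A precursor of `⊔-∼⊓-comm`. The guard comes out doubled, which `⊔-contradiction` undoes by
  -- using the lemma once in each direction.
  ⊔-∼⊓-double : ∀ x y → x ⊔ (∼ x ⊓ y) ≋ (∼ x ⊓ (∼ x ⊓ y)) ⊔ x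
  ⊔-∼⊓-double x y = begin
    x ⊔ (∼ x ⊓ y)                                 ≈⟨ excluded-middle-⊔-identity x (∼ x ⊓ y) ⟨
    (x ⊔ ∼ x) ⊓ (x ⊔ (∼ x ⊓ y))                   ≈⟨ ⊓-mem-⊔ˡ x (∼ x) (∼ x ⊓ y) ⟩
    (∼ x ⊓ (∼ x ⊓ (x ⊔ (∼ x ⊓ y)))) ⊔ x           ≈⟨ ⊔-congʳ (⊓-congˡ (⊓-remember (∼ x) y)) ⟩
    (∼ x ⊓ (∼ x ⊓ y)) ⊔ x                         ∎

  ⊔-contradiction : ∀ x → x ⊔ (∼ x ⊓ (x ⊓ ∼ x)) ≋ x
  ⊔-contradiction x = begin
    x ⊔ (∼ x ⊓ (x ⊓ ∼ x))                 ≈⟨ ⊔-∼⊓-double x (x ⊓ ∼ x) ⟩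
    (∼ x ⊓ (∼ x ⊓ (x ⊓ ∼ x))) ⊔ x         ≈⟨ ∼-cong (⊔-⊔-excluded-middle-⊓ x x (∼ x)) ⟩
    (∼ x ⊓ (∼ x ⊓ x)) ⊔ x                 ≈⟨ ⊔-∼⊓-double x x ⟨
    x ⊔ (∼ x ⊓ x)                         ≈⟨ ∼-cong (⊓-excluded-middle (∼ x)) ⟩
    x                                     ∎

  ⊔-excluded-middle-comm : ∀ x → x ⊔ (∼ x ⊔ x) ≋ x ⊔ ∼ x
  ⊔-excluded-middle-comm x = begin
    x ⊔ (∼ x ⊔ x)                         ≈⟨ ⊔-remember x (∼ x ⊔ x) ⟨
    x ⊔ (∼ x ⊓ (x ⊔ (∼ x ⊔ x)))           ≈⟨ ⊔-congˡ (∼-cong (⊔-contradiction x)) ⟩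
    x ⊔ ∼ x                               ∎

  ⊔-excluded-middle : ∀ x → x ⊔ (x ⊔ ∼ x) ≋ ∼ x ⊔ x
  ⊔-excluded-middle x = begin
    x ⊔ (x ⊔ ∼ x)                                             ≈⟨ ⊓-abs (x ⊔ (x ⊔ ∼ x)) (∼ x ⊔ x) ⟨
    (x ⊔ (x ⊔ ∼ x)) ⊓ ((x ⊔ (x ⊔ ∼ x)) ⊔ (∼ x ⊔ x))           ≈⟨ ⊓-congˡ (∼-cong (⊓-contradiction (∼ x))) ⟨
    (x ⊔ (x ⊔ ∼ x)) ⊓ (x ⊔ (∼ x ⊔ x))                         ≈⟨ ⊓-congˡ (⊔-excluded-middle-comm x) ⟩
    (x ⊔ (x ⊔ ∼ x)) ⊓ (x ⊔ ∼ x)                               ≈⟨ ⊔-⊔-⊓-⊔ x (∼ x) ⟩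
    (∼ x ⊓ (x ⊔ ∼ x)) ⊔ x                                     ≈⟨ ⊔-congʳ (⊓-excluded-middle (∼ x)) ⟩
    ∼ x ⊔ x                                                   ∎

  ⊔-excluded-middle-⊓-⊔ : ∀ x y z → (x ⊔ (y ⊔ ∼ y)) ⊓ (y ⊔ z) ≋ (x ⊔ (y ⊔ z)) ⊓ (y ⊔ z)
  ⊔-excluded-middle-⊓-⊔ x y z = begin
    (x ⊔ (y ⊔ ∼ y)) ⊓ (y ⊔ z)                                     ≈⟨ ⊓-congʳ (⊔-congˡ (⊔-excluded-middle (∼ y))) ⟨
    (x ⊔ (∼ y ⊔ (∼ y ⊔ y))) ⊓ (y ⊔ z)                             ≈⟨ ⊓-mem x (∼ y ⊔ (∼ y ⊔ y)) (y ⊔ z) ⟩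
    (∼ x ⊓ ((∼ y ⊔ (∼ y ⊔ y)) ⊓ (y ⊔ z))) ⊔ (x ⊓ (y ⊔ z))         ≈⟨ ⊔-congʳ (⊓-congˡ (⊔-excluded-middle-identityˡ (∼ y) z)) ⟩
    (∼ x ⊓ (y ⊔ z)) ⊔ (x ⊓ (y ⊔ z))                               ≈⟨ ⊓-mem-self x (y ⊔ z) ⟨
    (x ⊔ (y ⊔ z)) ⊓ (y ⊔ z)                                       ∎

  ∼⊓⊔-⊔ : ∀ x y → (∼ x ⊓ (x ⊔ y)) ⊔ x ≋ x ⊔ y
  ∼⊓⊔-⊔ x y = begin
    (∼ x ⊓ (x ⊔ y)) ⊔ x                   ≈⟨ ⊔-⊔-⊓-⊔ x y ⟨
    (x ⊔ (x ⊔ y)) ⊓ (x ⊔ y)               ≈⟨ ⊔-excluded-middle-⊓-⊔ x x y ⟨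
    (x ⊔ (x ⊔ ∼ x)) ⊓ (x ⊔ y)             ≈⟨ ⊓-congʳ (⊔-excluded-middle x) ⟩
    (∼ x ⊔ x) ⊓ (x ⊔ y)                   ≈⟨ ⊓-congʳ (excluded-middle-comm x) ⟨
    (x ⊔ ∼ x) ⊓ (x ⊔ y)                   ≈⟨ excluded-middle-⊔-identity x y ⟩
    x ⊔ y                                 ∎

  -- `∼⊓⊔-⊔` brings the guarded disjunct to the front, and `⊓-remember` strips the `x` that it picks
  -- up on the way.
  ⊔-∼⊓-comm : ∀ x y → x ⊔ (∼ x ⊓ y) ≋ (∼ x ⊓ y) ⊔ x
  ⊔-∼⊓-comm x y = begin
    x ⊔ (∼ x ⊓ y)                         ≈⟨ ∼⊓⊔-⊔ x (∼ x ⊓ y) ⟨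
    (∼ x ⊓ (x ⊔ (∼ x ⊓ y))) ⊔ x           ≈⟨ ⊔-congʳ (⊓-remember (∼ x) y) ⟩
    (∼ x ⊓ y) ⊔ x                         ∎

  ⊓-∼⊔-comm : ∀ x y → x ⊓ (∼ x ⊔ y) ≋ (∼ x ⊔ y) ⊓ x
  ⊓-∼⊔-comm x y = ∼-cong (⊔-∼⊓-comm (∼ x) (∼ y))

  ⊓-⊔-⊓-⊔ : ∀ x y z → x ⊓ ((x ⊔ y) ⊓ (x ⊔ z)) ≋ x
  ⊓-⊔-⊓-⊔ x y z = begin
    x ⊓ ((x ⊔ y) ⊓ (x ⊔ z))                   ≈⟨ ⊓-congˡ (⊓-mem-⊔ˡ x y z) ⟩
    x ⊓ ((∼ x ⊓ (y ⊓ (x ⊔ z))) ⊔ x)           ≈⟨ ⊓-congˡ (⊔-∼⊓-comm x (y ⊓ (x ⊔ z))) ⟨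
    x ⊓ (x ⊔ (∼ x ⊓ (y ⊓ (x ⊔ z))))           ≈⟨ ⊓-abs x (∼ x ⊓ (y ⊓ (x ⊔ z))) ⟩
    x                                         ∎

  ⊔-∼⊔-identityˡ : ∀ x y z → (x ⊔ (∼ x ⊔ y)) ⊓ (∼ x ⊔ z) ≋ ∼ x ⊔ z
  ⊔-∼⊔-identityˡ x y z = begin
    (x ⊔ (∼ x ⊔ y)) ⊓ (∼ x ⊔ z)                                   ≈⟨ ⊓-mem x (∼ x ⊔ y) (∼ x ⊔ z) ⟩
    (∼ x ⊓ ((∼ x ⊔ y) ⊓ (∼ x ⊔ z))) ⊔ (x ⊓ (∼ x ⊔ z))             ≈⟨ ⊔-congʳ (⊓-⊔-⊓-⊔ (∼ x) y z) ⟩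
    ∼ x ⊔ (x ⊓ (∼ x ⊔ z))                                         ≈⟨ ⊔-remember (∼ x) z ⟩
    ∼ x ⊔ z                                                       ∎

  ⊓-∼⊔-⊔ : ∀ x y → x ⊓ (∼ x ⊔ (x ⊔ y)) ≋ x
  ⊓-∼⊔-⊔ x y = begin
    x ⊓ (∼ x ⊔ (x ⊔ y))               ≈⟨ ⊓-∼⊔-comm x (x ⊔ y) ⟩
    (∼ x ⊔ (x ⊔ y)) ⊓ x               ≈⟨ ⊓-congˡ (⊔-idem x) ⟨
    (∼ x ⊔ (x ⊔ y)) ⊓ (x ⊔ x)         ≈⟨ ⊔-∼⊔-identityˡ (∼ x) y x ⟩
    x ⊔ x                             ≈⟨ ⊔-idem x ⟩
    x                                 ∎

  -- After `x` fails, `∼ x` succeeds and `y` is never reached: once `⊔-remember` has added the guard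
  -- `∼ x`, the inner join collapses by `⊓-∼⊔-⊔`.
  ⊔-∼⊔ : ∀ x y → x ⊔ (∼ x ⊔ y) ≋ x ⊔ ∼ x
  ⊔-∼⊔ x y = begin
    x ⊔ (∼ x ⊔ y)                         ≈⟨ ⊔-remember x (∼ x ⊔ y) ⟨
    x ⊔ (∼ x ⊓ (x ⊔ (∼ x ⊔ y)))           ≈⟨ ⊔-congˡ (⊓-∼⊔-⊔ (∼ x) y) ⟩
    x ⊔ ∼ x                               ∎

  ⊓-∼⊓ : ∀ x y → x ⊓ (∼ x ⊓ y) ≋ x ⊓ ∼ x
  ⊓-∼⊓ x y = ∼-cong (⊔-∼⊔ (∼ x) (∼ y))

  ⊔-∼⊓-⊓-⊔ : ∀ x y z → x ⊔ (∼ x ⊓ ((x ⊓ y) ⊔ z)) ≋ x ⊔ z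
  ⊔-∼⊓-⊓-⊔ x y z = begin
    x ⊔ (∼ x ⊓ ((x ⊓ y) ⊔ z))                         ≈⟨ ⊔-∼⊓-comm x ((x ⊓ y) ⊔ z) ⟩
    (∼ x ⊓ ((x ⊓ y) ⊔ z)) ⊔ x                         ≈⟨ ⊔-congʳ (⊓-congˡ (⊔-mem x y z)) ⟩
    (∼ x ⊓ ((∼ x ⊔ (y ⊔ z)) ⊓ (x ⊔ z))) ⊔ x           ≈⟨ ⊓-mem-⊔ˡ x (∼ x ⊔ (y ⊔ z)) z ⟨
    (x ⊔ (∼ x ⊔ (y ⊔ z))) ⊓ (x ⊔ z)                   ≈⟨ ⊓-congʳ (⊔-∼⊔ x (y ⊔ z)) ⟩
    (x ⊔ ∼ x) ⊓ (x ⊔ z)                               ≈⟨ excluded-middle-⊔-identity x z ⟩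
    x ⊔ z                                             ∎

  ⊔-∼⊔-⊓ : ∀ x y z → x ⊔ ((∼ x ⊔ y) ⊓ z) ≋ x ⊔ (∼ x ⊓ z)
  ⊔-∼⊔-⊓ x y z = begin
    x ⊔ ((∼ x ⊔ y) ⊓ z)                           ≈⟨ ⊔-remember x ((∼ x ⊔ y) ⊓ z) ⟨
    x ⊔ (∼ x ⊓ (x ⊔ ((∼ x ⊔ y) ⊓ z)))             ≈⟨ ⊔-congˡ (∼-cong (⊔-∼⊓-⊓-⊔ x (∼ y) (∼ z))) ⟩
    x ⊔ (∼ x ⊓ z)                                 ∎

  -- Behind `x`, the first factor produced by the dual of Mem counts only as `∼ x`, and `⊔-remember`
  -- removes that guard.
  ⊔-⊓-⊔ : ∀ x y z → x ⊔ ((x ⊓ y) ⊔ z) ≋ x ⊔ z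
  ⊔-⊓-⊔ x y z = begin
    x ⊔ ((x ⊓ y) ⊔ z)                         ≈⟨ ⊔-congˡ (⊔-mem x y z) ⟩
    x ⊔ ((∼ x ⊔ (y ⊔ z)) ⊓ (x ⊔ z))           ≈⟨ ⊔-∼⊔-⊓ x (y ⊔ z) (x ⊔ z) ⟩
    x ⊔ (∼ x ⊓ (x ⊔ z))                       ≈⟨ ⊔-remember x z ⟩
    x ⊔ z                                     ∎

  -- Used in place of associativity: a factor `x ⊔ y` may be inserted or dropped after `x`.
  ⊓-⊔-⊓ : ∀ x y z → x ⊓ ((x ⊔ y) ⊓ z) ≋ x ⊓ z
  ⊓-⊔-⊓ x y z = ∼-cong (⊔-⊓-⊔ (∼ x) (∼ y) (∼ z))

  ⊓-absorbs-⊔-⊔ : ∀ x y z → x ⊓ ((x ⊔ y) ⊔ z) ≋ x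
  ⊓-absorbs-⊔-⊔ x y z = begin
    x ⊓ ((x ⊔ y) ⊔ z)                     ≈⟨ ⊓-⊔-⊓ x y ((x ⊔ y) ⊔ z) ⟨
    x ⊓ ((x ⊔ y) ⊓ ((x ⊔ y) ⊔ z))         ≈⟨ ⊓-congˡ (⊓-abs (x ⊔ y) z) ⟩
    x ⊓ (x ⊔ y)                           ≈⟨ ⊓-abs x y ⟩
    x                                     ∎

  ⊓-⊓ : ∀ x y → x ⊓ (x ⊓ y) ≋ x ⊓ y
  ⊓-⊓ x y = begin
    x ⊓ (x ⊓ y)               ≈⟨ ⊓-congˡ (⊓-congʳ (⊔-idem x)) ⟨
    x ⊓ ((x ⊔ x) ⊓ y)         ≈⟨ ⊓-⊔-⊓ x x y ⟩
    x ⊓ y                     ∎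

  ⊔-⊔ : ∀ x y → x ⊔ (x ⊔ y) ≋ x ⊔ y
  ⊔-⊔ x y = ∼-cong (⊓-⊓ (∼ x) (∼ y))

  split : ∀ x y → (x ⊔ ∼ x) ⊓ y ≋ (x ⊓ y) ⊔ (∼ x ⊓ y)
  split x y = begin
    (x ⊔ ∼ x) ⊓ y                     ≈⟨ ⊓-congʳ (excluded-middle-comm x) ⟩
    (∼ x ⊔ x) ⊓ y                     ≈⟨ ⊓-mem (∼ x) x y ⟩
    (x ⊓ (x ⊓ y)) ⊔ (∼ x ⊓ y)         ≈⟨ ⊔-congʳ (⊓-⊓ x y) ⟩
    (x ⊓ y) ⊔ (∼ x ⊓ y)               ∎

  ⊔-⊓-right : ∀ x y → (x ⊔ y) ⊓ y ≋ (x ⊔ ∼ x) ⊓ y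
  ⊔-⊓-right x y = begin
    (x ⊔ y) ⊓ y               ≈⟨ ⊓-mem-self x y ⟩
    (∼ x ⊓ y) ⊔ (x ⊓ y)       ≈⟨ split (∼ x) y ⟨
    (∼ x ⊔ x) ⊓ y             ≈⟨ ⊓-congʳ (excluded-middle-comm x) ⟨
    (x ⊔ ∼ x) ⊓ y             ∎

  ⊓-⊔-right : ∀ x y → (x ⊓ y) ⊔ y ≋ (x ⊓ ∼ x) ⊔ y
  ⊓-⊔-right x y = ∼-cong (⊔-⊓-right (∼ x) (∼ y))

  contradiction-⊔ : ∀ x y → (x ⊓ ∼ x) ⊔ (∼ x ⊔ y) ≋ ∼ x ⊔ y
  contradiction-⊔ x y = begin
    (x ⊓ ∼ x) ⊔ (∼ x ⊔ y)                 ≈⟨ ⊔-congʳ (contradiction-comm x) ⟩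
    (∼ x ⊓ x) ⊔ (∼ x ⊔ y)                 ≈⟨ ⊓-⊔-right (∼ x) (∼ x ⊔ y) ⟨
    (∼ x ⊓ (∼ x ⊔ y)) ⊔ (∼ x ⊔ y)         ≈⟨ ⊔-congʳ (⊓-abs (∼ x) y) ⟩
    ∼ x ⊔ (∼ x ⊔ y)                       ≈⟨ ⊔-⊔ (∼ x) y ⟩
    ∼ x ⊔ y                               ∎

  -- The negation of `x ⊓ ∼ x` absorbs `x ⊓ ∼ x` on its left, so `⊓-remember` turns the meet with
  -- `y` into an instance of absorption.
  contradiction-⊓ : ∀ x y → (x ⊓ ∼ x) ⊓ y ≋ x ⊓ ∼ x
  contradiction-⊓ x y = begin
    e ⊓ y                                         ≈⟨ ⊓-remember e y ⟨
    e ⊓ ((∼ x ⊔ x) ⊔ (e ⊓ y))                     ≈⟨ ⊓-congˡ (⊔-congʳ (contradiction-⊔ x x)) ⟨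
    e ⊓ ((e ⊔ (∼ x ⊔ x)) ⊔ (e ⊓ y))               ≈⟨ ⊓-absorbs-⊔-⊔ e (∼ x ⊔ x) (e ⊓ y) ⟩
    e                                             ∎
    where e = x ⊓ ∼ x

  excluded-middle-⊔ : ∀ x y → (x ⊔ ∼ x) ⊔ y ≋ x ⊔ ∼ x
  excluded-middle-⊔ x y = ∼-cong (contradiction-⊓ (∼ x) (∼ y))

  contradiction-identityˡ : ∀ x y → (∼ x ⊓ x) ⊔ (x ⊓ y) ≋ x ⊓ y
  contradiction-identityˡ x y = begin
    (∼ x ⊓ x) ⊔ (x ⊓ y)               ≈⟨ ⊔-congʳ (⊓-∼⊓ (∼ x) y) ⟨
    (∼ x ⊓ (x ⊓ y)) ⊔ (x ⊓ y)         ≈⟨ ⊓-mem x x y ⟨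
    (x ⊔ x) ⊓ y                       ≈⟨ ⊓-congʳ (⊔-idem x) ⟩
    x ⊓ y                             ∎

  -- With associativity this would be absorption in `y`. Instead a factor `(x ⊓ y) ⊔ y` is inserted
  -- and rewritten until Mem yields a join headed by `x ⊓ y`, which is absorbed.
  ⊓-⊓-⊔ʳ : ∀ x y z → (x ⊓ y) ⊓ (y ⊔ z) ≋ x ⊓ y
  ⊓-⊓-⊔ʳ x y z = begin
    (x ⊓ y) ⊓ (y ⊔ z)                                                 ≈⟨ ⊓-⊔-⊓ (x ⊓ y) y (y ⊔ z) ⟨
    (x ⊓ y) ⊓ (((x ⊓ y) ⊔ y) ⊓ (y ⊔ z))                               ≈⟨ ⊓-congˡ (⊓-congʳ (⊓-⊔-right x y)) ⟩
    (x ⊓ y) ⊓ (((x ⊓ ∼ x) ⊔ y) ⊓ (y ⊔ z))                             ≈⟨ ⊓-congˡ (⊓-mem-⊔ʳ (x ⊓ ∼ x) y z) ⟩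
    (x ⊓ y) ⊓ (((∼ x ⊔ x) ⊓ y) ⊔ ((x ⊓ ∼ x) ⊓ (y ⊔ z)))               ≈⟨ ⊓-congˡ (⊔-congʳ (⊓-congʳ (excluded-middle-comm x))) ⟨
    (x ⊓ y) ⊓ (((x ⊔ ∼ x) ⊓ y) ⊔ ((x ⊓ ∼ x) ⊓ (y ⊔ z)))               ≈⟨ ⊓-congˡ (⊔-congʳ (split x y)) ⟩
    (x ⊓ y) ⊓ (((x ⊓ y) ⊔ (∼ x ⊓ y)) ⊔ ((x ⊓ ∼ x) ⊓ (y ⊔ z)))         ≈⟨ ⊓-absorbs-⊔-⊔ (x ⊓ y) (∼ x ⊓ y) _ ⟩
    x ⊓ y                                                             ∎

  ⊓-⊓-right : ∀ x y → (x ⊓ y) ⊓ y ≋ x ⊓ y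
  ⊓-⊓-right x y = begin
    (x ⊓ y) ⊓ y               ≈⟨ ⊓-congˡ (⊔-idem y) ⟨
    (x ⊓ y) ⊓ (y ⊔ y)         ≈⟨ ⊓-⊓-⊔ʳ x y y ⟩
    x ⊓ y                     ∎

  -- Rewriting `x ⊓ y` so that `x` is its last factor reduces this to `⊓-⊓-⊔ʳ`.
  ⊓-⊓-⊔ˡ : ∀ x y z → (x ⊓ y) ⊓ (x ⊔ z) ≋ x ⊓ y
  ⊓-⊓-⊔ˡ x y z = begin
    (x ⊓ y) ⊓ (x ⊔ z)                         ≈⟨ ⊓-congʳ swapped ⟩
    ((∼ x ⊔ (x ⊓ y)) ⊓ x) ⊓ (x ⊔ z)           ≈⟨ ⊓-⊓-⊔ʳ (∼ x ⊔ (x ⊓ y)) x z ⟩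
    (∼ x ⊔ (x ⊓ y)) ⊓ x                       ≈⟨ swapped ⟨
    x ⊓ y                                     ∎
    where
    swapped : x ⊓ y ≋ (∼ x ⊔ (x ⊓ y)) ⊓ x
    swapped = begin
      x ⊓ y                         ≈⟨ ⊓-remember x y ⟨
      x ⊓ (∼ x ⊔ (x ⊓ y))           ≈⟨ ⊓-∼⊔-comm x (x ⊓ y) ⟩
      (∼ x ⊔ (x ⊓ y)) ⊓ x           ∎

  ⊓-⊓-left : ∀ x y → (x ⊓ y) ⊓ x ≋ x ⊓ y
  ⊓-⊓-left x y = begin
    (x ⊓ y) ⊓ x               ≈⟨ ⊓-congˡ (⊔-idem x) ⟨
    (x ⊓ y) ⊓ (x ⊔ x)         ≈⟨ ⊓-⊓-⊔ˡ x y x ⟩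
    x ⊓ y                     ∎

  excluded-middle-identityʳ : ∀ x y → (x ⊔ y) ⊓ (∼ x ⊔ x) ≋ x ⊔ y
  excluded-middle-identityʳ x y = begin
    (x ⊔ y) ⊓ (∼ x ⊔ x)                           ≈⟨ ⊓-congˡ (excluded-middle-comm x) ⟨
    (x ⊔ y) ⊓ (x ⊔ ∼ x)                           ≈⟨ ⊓-congˡ (excluded-middle-⊔ x x) ⟨
    (x ⊔ y) ⊓ ((x ⊔ ∼ x) ⊔ x)                     ≈⟨ ⊓-congʳ (excluded-middle-⊔-identity x y) ⟨
    ((x ⊔ ∼ x) ⊓ (x ⊔ y)) ⊓ ((x ⊔ ∼ x) ⊔ x)       ≈⟨ ⊓-⊓-⊔ˡ (x ⊔ ∼ x) (x ⊔ y) x ⟩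
    (x ⊔ ∼ x) ⊓ (x ⊔ y)                           ≈⟨ excluded-middle-⊔-identity x y ⟩
    x ⊔ y                                         ∎

  contradiction-identityʳ : ∀ x y → (x ⊓ y) ⊔ (∼ x ⊓ x) ≋ x ⊓ y
  contradiction-identityʳ x y = ∼-cong (excluded-middle-identityʳ (∼ x) (∼ y))

  ⊔-⊔-self : ∀ x y → x ⊔ (y ⊔ x) ≋ x ⊔ (∼ x ⊓ y)
  ⊔-⊔-self x y = begin
    -- The added factor is the second one in the dual of Mem for `(∼ x ⊓ y) ⊔ x`.
    x ⊔ (y ⊔ x)                       ≈⟨ excluded-middle-identityʳ x (y ⊔ x) ⟨
    (x ⊔ (y ⊔ x)) ⊓ (∼ x ⊔ x)         ≈⟨ ⊔-mem (∼ x) y x ⟨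
    (∼ x ⊓ y) ⊔ x                     ≈⟨ ⊔-∼⊓-comm x y ⟨
    x ⊔ (∼ x ⊓ y)                     ∎

  ⊔-∼⊓-∼ : ∀ x y → x ⊔ (∼ x ⊓ (y ⊓ ∼ x)) ≋ x ⊔ y
  ⊔-∼⊓-∼ x y = begin
    x ⊔ (∼ x ⊓ (y ⊓ ∼ x))         ≈⟨ ⊔-congˡ (∼-cong (⊔-⊔-self x (∼ y))) ⟩
    x ⊔ (∼ x ⊓ (x ⊔ y))           ≈⟨ ⊔-remember x y ⟩
    x ⊔ y                         ∎

  -- The instances of `⊔-∼⊓-∼` at `y ⊓ ∼ x` and at `y` have the same left-hand side by `⊓-⊓-right`.
  ⊔-⊓∼ : ∀ x y → x ⊔ (y ⊓ ∼ x) ≋ x ⊔ y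
  ⊔-⊓∼ x y = begin
    x ⊔ (y ⊓ ∼ x)                         ≈⟨ ⊔-∼⊓-∼ x (y ⊓ ∼ x) ⟨
    x ⊔ (∼ x ⊓ ((y ⊓ ∼ x) ⊓ ∼ x))         ≈⟨ ⊔-congˡ (⊓-congˡ (⊓-⊓-right y (∼ x))) ⟩
    x ⊔ (∼ x ⊓ (y ⊓ ∼ x))                 ≈⟨ ⊔-∼⊓-∼ x y ⟩
    x ⊔ y                                 ∎

  ⊓-⊔∼ : ∀ x y → x ⊓ (y ⊔ ∼ x) ≋ x ⊓ y
  ⊓-⊔∼ x y = ∼-cong (⊔-⊓∼ (∼ x) (∼ y))

  -- Reasoning behind a guard `x`.

  select-true : ∀ x y z → x ⊓ (y ⊔ (∼ x ⊓ z)) ≋ x ⊓ y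
  select-true x y z = begin
    -- The inserted factor `x ⊔ ∼ z` is the negation of the second disjunct, which `⊓-⊔∼` can then
    -- delete.
    x ⊓ (y ⊔ (∼ x ⊓ z))                       ≈⟨ ⊓-⊔-⊓ x (∼ z) (y ⊔ (∼ x ⊓ z)) ⟨
    x ⊓ ((x ⊔ ∼ z) ⊓ (y ⊔ (∼ x ⊓ z)))         ≈⟨ ⊓-congˡ (⊓-⊔∼ (x ⊔ ∼ z) y) ⟩
    x ⊓ ((x ⊔ ∼ z) ⊓ y)                       ≈⟨ ⊓-⊔-⊓ x (∼ z) y ⟩
    x ⊓ y                                     ∎

  ⊓-∼⊔-⊓ : ∀ x y z → x ⊓ ((∼ x ⊔ y) ⊓ z) ≋ x ⊓ (y ⊓ z)
  ⊓-∼⊔-⊓ x y z = begin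
    x ⊓ ((∼ x ⊔ y) ⊓ z)                       ≈⟨ ⊓-congˡ (⊓-mem (∼ x) y z) ⟩
    x ⊓ ((x ⊓ (y ⊓ z)) ⊔ (∼ x ⊓ z))           ≈⟨ select-true x (x ⊓ (y ⊓ z)) z ⟩
    x ⊓ (x ⊓ (y ⊓ z))                         ≈⟨ ⊓-⊓ x (y ⊓ z) ⟩
    x ⊓ (y ⊓ z)                               ∎

  ⊓-⊓-self-⊓ : ∀ x y z → x ⊓ ((y ⊓ x) ⊓ z) ≋ x ⊓ (y ⊓ z)
  ⊓-⊓-self-⊓ x y z = begin
    -- The detour through `∼ x ⊔ (y ⊓ x)` exposes the trailing `x` to `⊔-⊓∼`.
    x ⊓ ((y ⊓ x) ⊓ z)                 ≈⟨ ⊓-∼⊔-⊓ x (y ⊓ x) z ⟨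
    x ⊓ ((∼ x ⊔ (y ⊓ x)) ⊓ z)         ≈⟨ ⊓-congˡ (⊓-congʳ (⊔-⊓∼ (∼ x) y)) ⟩
    x ⊓ ((∼ x ⊔ y) ⊓ z)               ≈⟨ ⊓-∼⊔-⊓ x y z ⟩
    x ⊓ (y ⊓ z)                       ∎

  ⊓-⊓-self : ∀ x y → x ⊓ (y ⊓ x) ≋ x ⊓ y
  ⊓-⊓-self x y = begin
    x ⊓ (y ⊓ x)                       ≈⟨ ⊓-congˡ (⊓-⊓-⊔ˡ y x x) ⟨
    x ⊓ ((y ⊓ x) ⊓ (y ⊔ x))           ≈⟨ ⊓-⊓-self-⊓ x y (y ⊔ x) ⟩
    x ⊓ (y ⊓ (y ⊔ x))                 ≈⟨ ⊓-congˡ (⊓-abs y x) ⟩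
    x ⊓ y                             ∎

  ⊔-∼⊓ : ∀ x y → x ⊔ (∼ x ⊓ y) ≋ x ⊔ y
  ⊔-∼⊓ x y = ≋-trans (≋-sym (⊔-⊔-self x y)) (∼-cong (⊓-⊓-self (∼ x) (∼ y)))

  ⊓-∼⊔ : ∀ x y → x ⊓ (∼ x ⊔ y) ≋ x ⊓ y
  ⊓-∼⊔ x y = ∼-cong (⊔-∼⊓ (∼ x) (∼ y))

  select-false : ∀ x y z → x ⊓ ((∼ x ⊓ y) ⊔ z) ≋ x ⊓ z
  select-false x y z = begin
    x ⊓ ((∼ x ⊓ y) ⊔ z)               ≈⟨ ⊓-∼⊔ x ((∼ x ⊓ y) ⊔ z) ⟨
    x ⊓ (∼ x ⊔ ((∼ x ⊓ y) ⊔ z))       ≈⟨ ⊓-congˡ (⊔-⊓-⊔ (∼ x) y z) ⟩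
    x ⊓ (∼ x ⊔ z)                     ≈⟨ ⊓-∼⊔ x z ⟩
    x ⊓ z                             ∎

  ⊓-⊓-⊓ : ∀ x y z → x ⊓ ((x ⊓ y) ⊓ z) ≋ x ⊓ (y ⊓ z)
  ⊓-⊓-⊓ x y z = begin
    x ⊓ ((x ⊓ y) ⊓ z)                 ≈⟨ ⊓-∼⊔-⊓ x (x ⊓ y) z ⟨
    x ⊓ ((∼ x ⊔ (x ⊓ y)) ⊓ z)         ≈⟨ ⊓-congˡ (⊓-congʳ (⊔-∼⊓ (∼ x) y)) ⟩
    x ⊓ ((∼ x ⊔ y) ⊓ z)               ≈⟨ ⊓-∼⊔-⊓ x y z ⟩
    x ⊓ (y ⊓ z)                       ∎

  -- Appending x on the right and distributing by Mem shows that, after x,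
  -- the value of y ⊔ z depends on z only through z ⊓ x.
  ⊓-⊔-∼⊔ : ∀ x y z → x ⊓ (y ⊔ (∼ x ⊔ z)) ≋ x ⊓ (y ⊔ (x ⊓ z))
  ⊓-⊔-∼⊔ x y z = begin
    x ⊓ (y ⊔ (∼ x ⊔ z))                               ≈⟨ ⊓-⊓-self x (y ⊔ (∼ x ⊔ z)) ⟨
    x ⊓ ((y ⊔ (∼ x ⊔ z)) ⊓ x)                         ≈⟨ ⊓-congˡ (⊓-mem y (∼ x ⊔ z) x) ⟩
    x ⊓ ((∼ y ⊓ ((∼ x ⊔ z) ⊓ x)) ⊔ (y ⊓ x))           ≈⟨ ⊓-congˡ (⊔-congʳ (⊓-congˡ same)) ⟩
    x ⊓ ((∼ y ⊓ ((x ⊓ z) ⊓ x)) ⊔ (y ⊓ x))             ≈⟨ ⊓-congˡ (⊓-mem y (x ⊓ z) x) ⟨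
    x ⊓ ((y ⊔ (x ⊓ z)) ⊓ x)                           ≈⟨ ⊓-⊓-self x (y ⊔ (x ⊓ z)) ⟩
    x ⊓ (y ⊔ (x ⊓ z))                                 ∎
    where
    same : (∼ x ⊔ z) ⊓ x ≋ (x ⊓ z) ⊓ x
    same = begin
      (∼ x ⊔ z) ⊓ x         ≈⟨ ⊓-∼⊔-comm x z ⟨
      x ⊓ (∼ x ⊔ z)         ≈⟨ ⊓-∼⊔ x z ⟩
      x ⊓ z                 ≈⟨ ⊓-⊓-left x z ⟨
      (x ⊓ z) ⊓ x           ∎

  ⊓-⊓-∼⊔ : ∀ x y z → x ⊓ (y ⊓ (∼ x ⊔ z)) ≋ x ⊓ (y ⊓ (x ⊓ z))
  ⊓-⊓-∼⊔ x y z = begin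
    x ⊓ (y ⊓ (∼ x ⊔ z))               ≈⟨ ⊓-∼⊔ x (y ⊓ (∼ x ⊔ z)) ⟨
    x ⊓ (∼ x ⊔ (y ⊓ (∼ x ⊔ z)))       ≈⟨ ⊓-congˡ (∼-cong (⊓-⊔-∼⊔ x (∼ y) (∼ z))) ⟨
    x ⊓ (∼ x ⊔ (y ⊓ (x ⊓ z)))         ≈⟨ ⊓-∼⊔ x (y ⊓ (x ⊓ z)) ⟩
    x ⊓ (y ⊓ (x ⊓ z))                 ∎

  ⊓-⊔∼-⊔ : ∀ x y z → x ⊓ ((y ⊔ ∼ x) ⊔ z) ≋ x ⊓ (y ⊔ z)
  ⊓-⊔∼-⊔ x y z = begin
    x ⊓ ((y ⊔ ∼ x) ⊔ z)               ≈⟨ ⊓-∼⊔ x ((y ⊔ ∼ x) ⊔ z) ⟨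
    x ⊓ (∼ x ⊔ ((y ⊔ ∼ x) ⊔ z))       ≈⟨ ⊓-congˡ (∼-cong (⊓-⊓-self-⊓ x (∼ y) (∼ z))) ⟩
    x ⊓ (∼ x ⊔ (y ⊔ z))               ≈⟨ ⊓-∼⊔ x (y ⊔ z) ⟩
    x ⊓ (y ⊔ z)                       ∎

  ⊓-⊓-⊓-self : ∀ x y z → x ⊓ (y ⊓ (x ⊓ z)) ≋ x ⊓ (y ⊓ z)
  ⊓-⊓-⊓-self x y z = begin
    x ⊓ (y ⊓ (x ⊓ z))                             ≈⟨ ⊓-⊓-∼⊔ x y z ⟨
    -- Behind `y`, the disjunct `∼ x` may grow to `∼ x ⊔ ∼ y`. This is the negation of `x ⊓ y`, so
    -- `⊓-∼⊔` deletes it once `x ⊓ y` stands in front.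
    x ⊓ (y ⊓ (∼ x ⊔ z))                           ≈⟨ ⊓-congˡ (⊓-⊔∼-⊔ y (∼ x) z) ⟨
    x ⊓ (y ⊓ ((∼ x ⊔ ∼ y) ⊔ z))                   ≈⟨ ⊓-⊓-⊓ x y ((∼ x ⊔ ∼ y) ⊔ z) ⟨
    x ⊓ ((x ⊓ y) ⊓ ((∼ x ⊔ ∼ y) ⊔ z))             ≈⟨ ⊓-congˡ (⊓-∼⊔ (x ⊓ y) z) ⟩
    x ⊓ ((x ⊓ y) ⊓ z)                             ≈⟨ ⊓-⊓-⊓ x y z ⟩
    x ⊓ (y ⊓ z)                                   ∎

  ⊓-⊔-⊓-self : ∀ x y z → x ⊓ (y ⊔ (x ⊓ z)) ≋ x ⊓ (y ⊔ z)
  ⊓-⊔-⊓-self x y z = begin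
    x ⊓ (y ⊔ (x ⊓ z))                 ≈⟨ ⊓-⊔-∼⊔ x y z ⟨
    x ⊓ (y ⊔ (∼ x ⊔ z))               ≈⟨ ⊓-∼⊔ x (y ⊔ (∼ x ⊔ z)) ⟨
    x ⊓ (∼ x ⊔ (y ⊔ (∼ x ⊔ z)))       ≈⟨ ⊓-congˡ (∼-cong (⊓-⊓-⊓-self x (∼ y) (∼ z))) ⟩
    x ⊓ (∼ x ⊔ (y ⊔ z))               ≈⟨ ⊓-∼⊔ x (y ⊔ z) ⟩
    x ⊓ (y ⊔ z)                       ∎

  -- Associativity and the distributive laws.

  ∼⊔-⊓-⊓ : ∀ x y z → (∼ x ⊔ y) ⊓ (x ⊓ z) ≋ x ⊓ (y ⊓ z)
  ∼⊔-⊓-⊓ x y z = begin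
    (∼ x ⊔ y) ⊓ (x ⊓ z)                               ≈⟨ ⊓-mem (∼ x) y (x ⊓ z) ⟩
    (x ⊓ (y ⊓ (x ⊓ z))) ⊔ (∼ x ⊓ (x ⊓ z))             ≈⟨ ⊔-congˡ (⊓-∼⊓ (∼ x) z) ⟩
    (x ⊓ (y ⊓ (x ⊓ z))) ⊔ (∼ x ⊓ x)                   ≈⟨ contradiction-identityʳ x (y ⊓ (x ⊓ z)) ⟩
    x ⊓ (y ⊓ (x ⊓ z))                                 ≈⟨ ⊓-⊓-⊓-self x y z ⟩
    x ⊓ (y ⊓ z)                                       ∎

  -- Turns a contradiction in `x` into one in `x ⊓ y`, the condition on which `⊓-⊓-⊓-distrib`
  -- branches.
  ∼-⊓-contradiction : ∀ x y → (∼ x ⊔ ∼ y) ⊓ (∼ x ⊓ x) ≋ (∼ x ⊔ ∼ y) ⊓ (x ⊓ y)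
  ∼-⊓-contradiction x y = begin
    (∼ x ⊔ ∼ y) ⊓ (∼ x ⊓ x)           ≈⟨ ⊓-congˡ (contradiction-comm x) ⟨
    (∼ x ⊔ ∼ y) ⊓ (x ⊓ ∼ x)           ≈⟨ ∼⊔-⊓-⊓ x (∼ y) (∼ x) ⟩
    x ⊓ (∼ y ⊓ ∼ x)                   ≈⟨ ⊓-congˡ (⊓-⊔∼ (∼ y) (∼ x)) ⟨
    x ⊓ (∼ y ⊓ (∼ x ⊔ y))             ≈⟨ ⊓-⊓-∼⊔ x (∼ y) y ⟩
    x ⊓ (∼ y ⊓ (x ⊓ y))               ≈⟨ ⊓-⊓-⊓-self x (∼ y) y ⟩
    x ⊓ (∼ y ⊓ y)                     ≈⟨ ∼⊔-⊓-⊓ x (∼ y) y ⟨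
    (∼ x ⊔ ∼ y) ⊓ (x ⊓ y)             ∎

  -- Mem is applied with `x ⊓ y` as the tested condition: the true branch is the left-hand side, and
  -- the false branch becomes a contradiction that the true branch absorbs.
  ⊓-⊓-⊓-distrib : ∀ x y z → (x ⊓ y) ⊓ (x ⊓ z) ≋ x ⊓ (y ⊓ z)
  ⊓-⊓-⊓-distrib x y z = ≋-sym (begin
    x ⊓ (y ⊓ z)                                                       ≈⟨ ∼⊔-⊓-⊓ x y z ⟨
    (∼ x ⊔ y) ⊓ (x ⊓ z)                                               ≈⟨ ⊓-congʳ (⊔-∼⊓ (∼ x) y) ⟨
    (∼ x ⊔ (x ⊓ y)) ⊓ (x ⊓ z)                                         ≈⟨ ⊓-congʳ (⊔-∼⊓-comm (∼ x) y) ⟩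
    ((x ⊓ y) ⊔ ∼ x) ⊓ (x ⊓ z)                                         ≈⟨ ⊓-mem (x ⊓ y) (∼ x) (x ⊓ z) ⟩
    ((∼ x ⊔ ∼ y) ⊓ (∼ x ⊓ (x ⊓ z))) ⊔ ((x ⊓ y) ⊓ (x ⊓ z))             ≈⟨ ⊔-congʳ (⊓-congˡ (⊓-∼⊓ (∼ x) z)) ⟩
    ((∼ x ⊔ ∼ y) ⊓ (∼ x ⊓ x)) ⊔ ((x ⊓ y) ⊓ (x ⊓ z))                   ≈⟨ ⊔-congʳ (∼-⊓-contradiction x y) ⟩
    ((∼ x ⊔ ∼ y) ⊓ (x ⊓ y)) ⊔ ((x ⊓ y) ⊓ (x ⊓ z))                     ≈⟨ contradiction-identityˡ (x ⊓ y) (x ⊓ z) ⟩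
    (x ⊓ y) ⊓ (x ⊓ z)                                                 ∎)

  -- A copy of `x` split off from `x ⊓ y` lets `⊓-⊓-⊓` work with `x ⊓ y` as its context.
  ⊓-assoc : ∀ x y z → (x ⊓ y) ⊓ z ≋ x ⊓ (y ⊓ z)
  ⊓-assoc x y z = begin
    (x ⊓ y) ⊓ z                               ≈⟨ ⊓-⊓ (x ⊓ y) z ⟨
    (x ⊓ y) ⊓ ((x ⊓ y) ⊓ z)                   ≈⟨ ⊓-congˡ (⊓-congʳ (⊓-⊓-left x y)) ⟨
    (x ⊓ y) ⊓ (((x ⊓ y) ⊓ x) ⊓ z)             ≈⟨ ⊓-⊓-⊓ (x ⊓ y) x z ⟩
    (x ⊓ y) ⊓ (x ⊓ z)                         ≈⟨ ⊓-⊓-⊓-distrib x y z ⟩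
    x ⊓ (y ⊓ z)                               ∎

  -- Read upwards: the dual of Mem expands the right-hand side, its second factor absorbs to `x`,
  -- and `⊓-∼⊔-comm` moves that `x` to the front.
  ⊓-distribˡ-⊔ : ∀ x y z → x ⊓ (y ⊔ z) ≋ (x ⊓ y) ⊔ (x ⊓ z)
  ⊓-distribˡ-⊔ x y z = begin
    x ⊓ (y ⊔ z)                                   ≈⟨ ⊓-⊔-⊓-self x y z ⟨
    x ⊓ (y ⊔ (x ⊓ z))                             ≈⟨ ⊓-∼⊔ x (y ⊔ (x ⊓ z)) ⟨
    x ⊓ (∼ x ⊔ (y ⊔ (x ⊓ z)))                     ≈⟨ ⊓-∼⊔-comm x (y ⊔ (x ⊓ z)) ⟩
    (∼ x ⊔ (y ⊔ (x ⊓ z))) ⊓ x                     ≈⟨ ⊓-congˡ (⊔-abs x z) ⟨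
    (∼ x ⊔ (y ⊔ (x ⊓ z))) ⊓ (x ⊔ (x ⊓ z))         ≈⟨ ⊔-mem x y (x ⊓ z) ⟨
    (x ⊓ y) ⊔ (x ⊓ z)                             ∎

  open Branches excluded-middle-comm split select-true select-false ⊓-⊓

  ⊓-distribʳ-⊔ : ∀ x y z → (x ⊔ y) ⊓ z ≋ (x ⊓ z) ⊔ (∼ x ⊓ (y ⊓ z))
  ⊓-distribʳ-⊔ x y z = ≋-trans (⊓-mem x y z) (branches-comm (∼ x) (y ⊓ z) z)

  derives-CL : E ⊩ Com → All (E ⊩_) CL
  derives-CL com
    = dneg
    -- De Morgan is the invariant stored with a meet.
    ∷ (λ σ → sym (neg≈¬pos (embed (σ 0) ⊓ embed (σ 1))))
    ∷ (λ σ → lower (⊓-assoc (embed (σ 0)) (embed (σ 1)) (embed (σ 2))))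
    ∷ (λ σ → lower (⊓-distribˡ-⊔ (embed (σ 0)) (embed (σ 1)) (embed (σ 2))))
    ∷ (λ σ → lower (⊓-distribʳ-⊔ (embed (σ 0)) (embed (σ 1)) (embed (σ 2))))
    ∷ (λ σ → lower (⊔-abs (embed (σ 0)) (embed (σ 1))))
    ∷ com
    ∷ []

-- From conditional logic to the short axioms.

module Conditional {K : Set} (E : List (Equation K)) (cl : All (E ⊩_) CL) where

  private
    ⊢-dneg     = All.lookup cl (here ≡.refl)
    ⊢-deMorgan = All.lookup cl (there (here ≡.refl))
    ⊢-assoc    = All.lookup cl (there (there (here ≡.refl)))
    ⊢-distribˡ = All.lookup cl (there (there (there (here ≡.refl))))
    ⊢-distribʳ = All.lookup cl (there (there (there (there (here ≡.refl)))))
    ⊢-abs      = All.lookup cl (there (there (there (there (there (here ≡.refl))))))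
    ⊢-com      = All.lookup cl (there (there (there (there (there (there (here ≡.refl)))))))

  or : E ⊩ Or
  or σ = sym (trans (⊢-deMorgan (assign (¬ σ 0) (¬ σ 1) (σ 1)))
    (∨-cong (⊢-dneg (λ _ → σ 0)) (⊢-dneg (λ _ → σ 1))))

  open Involution E ⊢-dneg or
  open SetoidReasoning setoid

  ⊔-abs : ∀ x y → x ⊔ (x ⊓ y) ≋ x
  ⊔-abs x y = lift (⊢-abs (assign (pos x) (pos y) (pos y)))

  ⊓-abs : ∀ x y → x ⊓ (x ⊔ y) ≋ x
  ⊓-abs x y = ∼-cong (⊔-abs (∼ x) (∼ y))

  ⊓-assoc : ∀ x y z → (x ⊓ y) ⊓ z ≋ x ⊓ (y ⊓ z)
  ⊓-assoc x y z = lift (⊢-assoc (assign (pos x) (pos y) (pos z)))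

  ⊔-assoc : ∀ x y z → (x ⊔ y) ⊔ z ≋ x ⊔ (y ⊔ z)
  ⊔-assoc x y z = ∼-cong (⊓-assoc (∼ x) (∼ y) (∼ z))

  ⊓-distribˡ-⊔ : ∀ x y z → x ⊓ (y ⊔ z) ≋ (x ⊓ y) ⊔ (x ⊓ z)
  ⊓-distribˡ-⊔ x y z = lift (⊢-distribˡ (assign (pos x) (pos y) (pos z)))

  ⊔-distribˡ-⊓ : ∀ x y z → x ⊔ (y ⊓ z) ≋ (x ⊔ y) ⊓ (x ⊔ z)
  ⊔-distribˡ-⊓ x y z = ∼-cong (⊓-distribˡ-⊔ (∼ x) (∼ y) (∼ z))

  ⊓-distribʳ-⊔ : ∀ x y z → (x ⊔ y) ⊓ z ≋ (x ⊓ z) ⊔ (∼ x ⊓ (y ⊓ z))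
  ⊓-distribʳ-⊔ x y z = lift (trans (⊢-distribʳ (assign (pos x) (pos y) (pos z)))
    (∨-cong refl (∧-cong (sym (neg≈¬pos x)) refl)))

  ⊔-com : ∀ x y → (x ⊓ y) ⊔ (y ⊓ x) ≋ (y ⊓ x) ⊔ (x ⊓ y)
  ⊔-com x y = lift (⊢-com (assign (pos x) (pos y) (pos y)))

  ⊓-com : ∀ x y → (x ⊔ y) ⊓ (y ⊔ x) ≋ (y ⊔ x) ⊓ (x ⊔ y)
  ⊓-com x y = ∼-cong (⊔-com (∼ x) (∼ y))

  ⊓-idem : ∀ x → x ⊓ x ≋ x
  ⊓-idem x = begin
    x ⊓ x                   ≈⟨ ⊓-congˡ (⊔-abs x x) ⟨
    x ⊓ (x ⊔ (x ⊓ x))       ≈⟨ ⊓-abs x (x ⊓ x) ⟩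
    x                       ∎

  ⊔-idem : ∀ x → x ⊔ x ≋ x
  ⊔-idem x = ∼-cong (⊓-idem (∼ x))

  ⊓-⊓ : ∀ x y → x ⊓ (x ⊓ y) ≋ x ⊓ y
  ⊓-⊓ x y = begin
    x ⊓ (x ⊓ y)         ≈⟨ ⊓-assoc x x y ⟨
    (x ⊓ x) ⊓ y         ≈⟨ ⊓-congʳ (⊓-idem x) ⟩
    x ⊓ y               ∎

  ⊓-⊔-⊓ : ∀ x y z → x ⊓ ((x ⊔ y) ⊓ z) ≋ x ⊓ z
  ⊓-⊔-⊓ x y z = begin
    x ⊓ ((x ⊔ y) ⊓ z)         ≈⟨ ⊓-assoc x (x ⊔ y) z ⟨
    (x ⊓ (x ⊔ y)) ⊓ z         ≈⟨ ⊓-congʳ (⊓-abs x y) ⟩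
    x ⊓ z                     ∎

  ⊔-⊓-⊔ : ∀ x y z → x ⊔ ((x ⊓ y) ⊔ z) ≋ x ⊔ z
  ⊔-⊓-⊔ x y z = ∼-cong (⊓-⊔-⊓ (∼ x) (∼ y) (∼ z))

  ⊓-⊓-⊔ : ∀ x y z → x ⊓ ((x ⊓ y) ⊔ z) ≋ x ⊓ (y ⊔ z)
  ⊓-⊓-⊔ x y z = begin
    x ⊓ ((x ⊓ y) ⊔ z)               ≈⟨ ⊓-distribˡ-⊔ x (x ⊓ y) z ⟩
    (x ⊓ (x ⊓ y)) ⊔ (x ⊓ z)         ≈⟨ ⊔-congʳ (⊓-⊓ x y) ⟩
    (x ⊓ y) ⊔ (x ⊓ z)               ≈⟨ ⊓-distribˡ-⊔ x y z ⟨
    x ⊓ (y ⊔ z)                     ∎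

  split : ∀ x y → (x ⊔ ∼ x) ⊓ y ≋ (x ⊓ y) ⊔ (∼ x ⊓ y)
  split x y = begin
    (x ⊔ ∼ x) ⊓ y                       ≈⟨ ⊓-distribʳ-⊔ x (∼ x) y ⟩
    (x ⊓ y) ⊔ (∼ x ⊓ (∼ x ⊓ y))         ≈⟨ ⊔-congˡ (⊓-⊓ (∼ x) y) ⟩
    (x ⊓ y) ⊔ (∼ x ⊓ y)                 ∎

  ⊔-⊓-right : ∀ x y → (x ⊔ y) ⊓ y ≋ (x ⊓ y) ⊔ (∼ x ⊓ y)
  ⊔-⊓-right x y = begin
    (x ⊔ y) ⊓ y                         ≈⟨ ⊓-distribʳ-⊔ x y y ⟩
    (x ⊓ y) ⊔ (∼ x ⊓ (y ⊓ y))           ≈⟨ ⊔-congˡ (⊓-congˡ (⊓-idem y)) ⟩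
    (x ⊓ y) ⊔ (∼ x ⊓ y)                 ∎

  ⊔-contradiction : ∀ x → x ⊔ (∼ x ⊓ x) ≋ x
  ⊔-contradiction x = begin
    x ⊔ (∼ x ⊓ x)                       ≈⟨ ⊔-congʳ (⊓-idem x) ⟨
    (x ⊓ x) ⊔ (∼ x ⊓ x)                 ≈⟨ ⊔-⊓-right x x ⟨
    (x ⊔ x) ⊓ x                         ≈⟨ ⊓-congʳ (⊔-idem x) ⟩
    x ⊓ x                               ≈⟨ ⊓-idem x ⟩
    x                                   ∎

  ⊔-excluded-middle : ∀ x → x ⊔ (∼ x ⊔ x) ≋ x ⊔ ∼ x
  ⊔-excluded-middle x = begin
    x ⊔ (∼ x ⊔ x)                           ≈⟨ ⊔-assoc x (∼ x) x ⟨
    (x ⊔ ∼ x) ⊔ x                           ≈⟨ ⊔-congˡ (⊔-contradiction x) ⟨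
    (x ⊔ ∼ x) ⊔ (x ⊔ (∼ x ⊓ x))             ≈⟨ ⊔-congˡ (⊔-distribˡ-⊓ x (∼ x) x) ⟩
    (x ⊔ ∼ x) ⊔ ((x ⊔ ∼ x) ⊓ (x ⊔ x))       ≈⟨ ⊔-abs (x ⊔ ∼ x) (x ⊔ x) ⟩
    x ⊔ ∼ x                                 ∎

  -- Each side equals the join of both, taken in its own order, and Com identifies the two orders.
  contradiction-comm : ∀ x → x ⊓ ∼ x ≋ ∼ x ⊓ x
  contradiction-comm x = begin
    x ⊓ ∼ x                     ≈⟨ both x ⟩
    (x ⊓ ∼ x) ⊔ (∼ x ⊓ x)       ≈⟨ ⊔-com x (∼ x) ⟩
    (∼ x ⊓ x) ⊔ (x ⊓ ∼ x)       ≈⟨ both (∼ x) ⟨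
    ∼ x ⊓ x                     ∎
    where
    both : ∀ x → x ⊓ ∼ x ≋ (x ⊓ ∼ x) ⊔ (∼ x ⊓ x)
    both x = begin
      x ⊓ ∼ x                           ≈⟨ ⊓-congʳ (⊔-idem x) ⟨
      (x ⊔ x) ⊓ ∼ x                     ≈⟨ ⊓-distribʳ-⊔ x x (∼ x) ⟩
      (x ⊓ ∼ x) ⊔ (∼ x ⊓ (x ⊓ ∼ x))     ≈⟨ ⊔-congˡ (∼-cong (⊔-excluded-middle x)) ⟩
      (x ⊓ ∼ x) ⊔ (∼ x ⊓ x)             ∎

  excluded-middle-comm : ∀ x → x ⊔ ∼ x ≋ ∼ x ⊔ x
  excluded-middle-comm x = ∼-cong (contradiction-comm (∼ x))

  ⊓-∼⊔ : ∀ x y → x ⊓ (∼ x ⊔ y) ≋ x ⊓ y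
  ⊓-∼⊔ x y = begin
    -- With the factor `x ⊔ y` inserted, the tail is the dual of the right-hand side of `⊔-⊓-right`.
    x ⊓ (∼ x ⊔ y)                 ≈⟨ ⊓-⊔-⊓ x y (∼ x ⊔ y) ⟨
    x ⊓ ((x ⊔ y) ⊓ (∼ x ⊔ y))     ≈⟨ ⊓-congˡ (∼-cong (⊔-⊓-right (∼ x) (∼ y))) ⟨
    x ⊓ ((x ⊓ y) ⊔ y)             ≈⟨ ⊓-⊓-⊔ x y y ⟩
    x ⊓ (y ⊔ y)                   ≈⟨ ⊓-congˡ (⊔-idem y) ⟩
    x ⊓ y                         ∎

  -- Expanding the last `x` by absorption creates a factor `x ⊔ y`. The dual of Com moves it to the
  -- front of its meet, where `x ⊔ y` absorbs the whole meet.
  ⊔-⊔-self : ∀ x y → x ⊔ (y ⊔ x) ≋ x ⊔ y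
  ⊔-⊔-self x y = begin
    x ⊔ (y ⊔ x)                             ≈⟨ ⊔-congˡ (⊔-congˡ (⊓-abs x y)) ⟨
    x ⊔ (y ⊔ (x ⊓ (x ⊔ y)))                 ≈⟨ ⊔-congˡ (∼-cong (⊓-⊓-⊔ (∼ y) (∼ x) (∼ x ⊓ ∼ y))) ⟨
    x ⊔ (y ⊔ ((y ⊔ x) ⊓ (x ⊔ y)))           ≈⟨ ⊔-assoc x y ((y ⊔ x) ⊓ (x ⊔ y)) ⟨
    (x ⊔ y) ⊔ ((y ⊔ x) ⊓ (x ⊔ y))           ≈⟨ ⊔-congˡ (⊓-com x y) ⟨
    (x ⊔ y) ⊔ ((x ⊔ y) ⊓ (y ⊔ x))           ≈⟨ ⊔-abs (x ⊔ y) (y ⊔ x) ⟩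
    x ⊔ y                                   ∎

  ⊓-⊔∼ : ∀ x y → x ⊓ (y ⊔ ∼ x) ≋ x ⊓ y
  ⊓-⊔∼ x y = begin
    x ⊓ (y ⊔ ∼ x)             ≈⟨ ⊓-∼⊔ x (y ⊔ ∼ x) ⟨
    x ⊓ (∼ x ⊔ (y ⊔ ∼ x))     ≈⟨ ⊓-congˡ (⊔-⊔-self (∼ x) y) ⟩
    x ⊓ (∼ x ⊔ y)             ≈⟨ ⊓-∼⊔ x y ⟩
    x ⊓ y                     ∎

  -- Distributing isolates `x ⊓ (∼ x ⊓ z)`, which equals `x ⊓ ∼ x`. Factoring `x` out again leaves
  -- only `∼ x` beside `y`.
  select-true : ∀ x y z → x ⊓ (y ⊔ (∼ x ⊓ z)) ≋ x ⊓ y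
  select-true x y z = begin
    x ⊓ (y ⊔ (∼ x ⊓ z))                   ≈⟨ ⊓-distribˡ-⊔ x y (∼ x ⊓ z) ⟩
    (x ⊓ y) ⊔ (x ⊓ (∼ x ⊓ z))             ≈⟨ ⊔-congˡ (⊓-∼⊔ x (∼ x ⊓ z)) ⟨
    (x ⊓ y) ⊔ (x ⊓ (∼ x ⊔ (∼ x ⊓ z)))     ≈⟨ ⊔-congˡ (⊓-congˡ (⊔-abs (∼ x) z)) ⟩
    (x ⊓ y) ⊔ (x ⊓ ∼ x)                   ≈⟨ ⊓-distribˡ-⊔ x y (∼ x) ⟨
    x ⊓ (y ⊔ ∼ x)                         ≈⟨ ⊓-⊔∼ x y ⟩
    x ⊓ y                                 ∎

  select-false : ∀ x y z → x ⊓ ((∼ x ⊓ y) ⊔ z) ≋ x ⊓ z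
  select-false x y z = begin
    x ⊓ ((∼ x ⊓ y) ⊔ z)               ≈⟨ ⊓-∼⊔ x ((∼ x ⊓ y) ⊔ z) ⟨
    x ⊓ (∼ x ⊔ ((∼ x ⊓ y) ⊔ z))       ≈⟨ ⊓-congˡ (⊔-⊓-⊔ (∼ x) y z) ⟩
    x ⊓ (∼ x ⊔ z)                     ≈⟨ ⊓-∼⊔ x z ⟩
    x ⊓ z                             ∎

  open Branches excluded-middle-comm split select-true select-false ⊓-⊓

  derives-Ax : All (E ⊩_) Ax
  derives-Ax
    = ⊢-dneg
    ∷ or
    ∷ (λ σ → lower (⊓-abs (embed (σ 0)) (embed (σ 1))))
    ∷ (λ σ → trans (⊢-distribʳ σ)
        (lower (branches-comm (embed (σ 0)) (embed (σ 2)) (embed (σ 1) ⊓ embed (σ 2)))))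
    ∷ ⊢-com
    ∷ []

-- Double negation from the axioms with `T`.

-- Every s equals (¬ T ∧ s) ∨ s, so by Or every term is a negation; and
-- ¬ ¬ ¬ s ≈ ¬ s because ¬ (¬ T ∧ ¬ s) ≈ T ∨ s ≈ T.
module WithTrue {u : Bool} (E : List (Equation (Constant true u)))
  (or : E ⊩ Or) (tand : E ⊩ Tand) (abs : E ⊩ Abs) (mem : E ⊩ Mem) where

  T∨ : ∀ s → E ⊢ const T ∨ s ≈ const T
  T∨ s = trans (sym (tand (λ _ → const T ∨ s))) (abs (assign (const T) s s))

  ¬⟨¬T∧¬⟩ : ∀ s → E ⊢ ¬ ((¬ const T) ∧ (¬ s)) ≈ const T
  ¬⟨¬T∧¬⟩ s = trans (sym (or (assign (const T) s s))) (T∨ s)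

  ¬T∧-∨ : ∀ s → E ⊢ ((¬ const T) ∧ s) ∨ s ≈ s
  ¬T∧-∨ s = trans (∨-cong (∧-cong refl (sym (tand (λ _ → s)))) (sym (tand (λ _ → s))))
    (trans (sym (mem (assign (const T) (const T) s)))
      (trans (∧-cong (T∨ (const T)) refl) (tand (λ _ → s))))

  triple-¬ : ∀ s → E ⊢ ¬ (¬ (¬ s)) ≈ ¬ s
  triple-¬ s = trans (¬-cong (sym (tand (λ _ → ¬ (¬ s)))))
    -- With `T` written as a negation, the term becomes an instance of the right-hand side of Or.
    (trans (¬-cong (∧-cong (sym (¬⟨¬T∧¬⟩ s)) refl))
      (trans (sym (or (assign ((¬ const T) ∧ (¬ s)) (¬ s) s))) (¬T∧-∨ (¬ s))))

  dneg : E ⊩ DNeg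
  dneg σ = trans (¬-cong (¬-cong (sym negation)))
    (trans (triple-¬ _) negation)
    where
    negation : E ⊢ ¬ ((¬ ((¬ const T) ∧ σ 0)) ∧ (¬ σ 0)) ≈ σ 0
    negation = trans (sym (or (assign ((¬ const T) ∧ σ 0) (σ 0) (σ 0)))) (¬T∧-∨ (σ 0))

-- Completeness of the four axiomatisations.

⊢-mono : ∀ {K} {E L : List (Equation K)} → All (E ⊩_) L → ∀ {e} → L ⊢ e → E ⊢ e
⊢-mono p (axiom e∈L σ)  = All.lookup p e∈L σ
⊢-mono p refl           = refl
⊢-mono p (sym d)        = sym (⊢-mono p d)
⊢-mono p (trans d d′)   = trans (⊢-mono p d) (⊢-mono p d′)
⊢-mono p (¬-cong d)     = ¬-cong (⊢-mono p d)
⊢-mono p (∧-cong d d′)  = ∧-cong (⊢-mono p d) (⊢-mono p d′)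
⊢-mono p (∨-cong d d′)  = ∨-cong (⊢-mono p d) (⊢-mono p d′)

completely-axiomatises : ∀ {K} {E L : List (Equation K)} →
  All (E ⊩_) L → All (L ⊩_) E → E CompletelyAxiomatises L
completely-axiomatises E⊩L L⊩E e = mk⇔ (⊢-mono L⊩E) (⊢-mono E⊩L)

axioms : ∀ {K} (E : List (Equation K)) → All (E ⊩_) E
axioms E = All.tabulate axiom

Ax₀-complete : Ax₀ CompletelyAxiomatises CL₀
Ax₀-complete = completely-axiomatises Ax⊩CL (Conditional.derives-Ax CL₀ (axioms CL₀))
  where
  Ax⊩CL : All (Ax₀ ⊩_) CL
  Ax⊩CL with dneg ∷ or ∷ abs ∷ mem ∷ com ∷ [] ← axioms Ax₀ =
    Memorising.derives-CL Ax₀ dneg or abs mem com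

Axᵁ-complete : Axᵁ CompletelyAxiomatises CLᵁ
Axᵁ-complete = completely-axiomatises Ax⊩CL CL⊩Ax
  where
  Ax⊩CL : All (Axᵁ ⊩_) CLᵁ
  Ax⊩CL with dneg ∷ und ∷ or ∷ abs ∷ mem ∷ com ∷ [] ← axioms Axᵁ =
    ++⁺ (Memorising.derives-CL Axᵁ dneg or abs mem com) (und ∷ [])

  CL⊩Ax : All (CLᵁ ⊩_) Axᵁ
  CL⊩Ax = insert (Conditional.derives-Ax CLᵁ (++⁻ˡ CL (axioms CLᵁ))) (++⁻ʳ CL (axioms CLᵁ))
    where
    insert : All (CLᵁ ⊩_) Ax → All (CLᵁ ⊩_) (Und ∷ []) → All (CLᵁ ⊩_) Axᵁ
    insert (dneg ∷ rest) (und ∷ []) = dneg ∷ und ∷ rest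

Ax₂-complete : Ax₂ CompletelyAxiomatises CL₂
Ax₂-complete = completely-axiomatises Ax⊩CL CL⊩Ax
  where
  Ax⊩CL : All (Ax₂ ⊩_) CL₂
  Ax⊩CL with neg ∷ or ∷ tand ∷ abs ∷ mem ∷ com ∷ [] ← axioms Ax₂ =
    ++⁺ (Memorising.derives-CL Ax₂ (WithTrue.dneg Ax₂ or tand abs mem) or abs mem com)
        (tand ∷ (λ σ → sym (neg σ)) ∷ [])

  CL⊩Ax : All (CL₂ ⊩_) Ax₂
  CL⊩Ax = insert (Conditional.derives-Ax CL₂ (++⁻ˡ CL (axioms CL₂))) (++⁻ʳ CL (axioms CL₂))
    where
    insert : All (CL₂ ⊩_) Ax → All (CL₂ ⊩_) (Tand ∷ ¬ const T ≈ const F ∷ []) → All (CL₂ ⊩_) Ax₂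
    insert (_ ∷ or ∷ rest) (tand ∷ neg ∷ []) = (λ σ → sym (neg σ)) ∷ or ∷ tand ∷ rest

Ax₃-complete : Ax₃ CompletelyAxiomatises CL₃
Ax₃-complete = completely-axiomatises Ax⊩CL CL⊩Ax
  where
  Ax⊩CL : All (Ax₃ ⊩_) CL₃
  Ax⊩CL with neg ∷ or ∷ tand ∷ abs ∷ mem ∷ com ∷ und ∷ [] ← axioms Ax₃ =
    ++⁺ (Memorising.derives-CL Ax₃ (WithTrue.dneg Ax₃ or tand abs mem) or abs mem com)
        (tand ∷ (λ σ → sym (neg σ)) ∷ und ∷ [])

  CL⊩Ax : All (CL₃ ⊩_) Ax₃
  CL⊩Ax = insert (Conditional.derives-Ax CL₃ (++⁻ˡ CL (axioms CL₃))) (++⁻ʳ CL (axioms CL₃))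
    where
    insert : All (CL₃ ⊩_) Ax → All (CL₃ ⊩_) (Tand ∷ ¬ const T ≈ const F ∷ Und ∷ []) →
      All (CL₃ ⊩_) Ax₃
    insert (_ ∷ or ∷ abs ∷ mem ∷ com ∷ []) (tand ∷ neg ∷ und ∷ []) =
      (λ σ → sym (neg σ)) ∷ or ∷ tand ∷ abs ∷ mem ∷ com ∷ und ∷ []

-- Finite algebras and decidable independence.

-- All three constants are always interpreted, so that one algebra can serve several signatures.
record Algebra : Set where
  field
    size      : ℕ
    ¬ᴬ        : Fin size → Fin size
    _∧ᴬ_ _∨ᴬ_ : Fin size → Fin size → Fin size
    Tᴬ Fᴬ Uᴬ  : Fin size

module Semantics {tf u : Bool} where

  K : Set
  K = Constant tf u

  module _ (A : Algebra) where
    open Algebra A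

    eval : Term K → (ℕ → Fin size) → Fin size
    eval (var n)   ρ = ρ n
    eval (const T) ρ = Tᴬ
    eval (const F) ρ = Fᴬ
    eval (const U) ρ = Uᴬ
    eval (¬ s)     ρ = ¬ᴬ (eval s ρ)
    eval (s ∧ t)   ρ = eval s ρ ∧ᴬ eval t ρ
    eval (s ∨ t)   ρ = eval s ρ ∨ᴬ eval t ρ

    Valid : Equation K → Set
    Valid (s ≈ t) = ∀ ρ → eval s ρ ≡ eval t ρ

    eval-[] : ∀ s σ ρ → eval (s [ σ ]) ρ ≡ eval s (λ n → eval (σ n) ρ)
    eval-[] (var n)   σ ρ = ≡.refl
    eval-[] (const T) σ ρ = ≡.refl
    eval-[] (const F) σ ρ = ≡.refl
    eval-[] (const U) σ ρ = ≡.refl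
    eval-[] (¬ s)     σ ρ = ≡.cong ¬ᴬ (eval-[] s σ ρ)
    eval-[] (s ∧ t)   σ ρ = ≡.cong₂ _∧ᴬ_ (eval-[] s σ ρ) (eval-[] t σ ρ)
    eval-[] (s ∨ t)   σ ρ = ≡.cong₂ _∨ᴬ_ (eval-[] s σ ρ) (eval-[] t σ ρ)

    sound : ∀ {E} → All Valid E → ∀ {e} → E ⊢ e → Valid e
    sound v (axiom {s} {t} e∈E σ) ρ =
      ≡.trans (eval-[] s σ ρ) (≡.trans (All.lookup v e∈E _) (≡.sym (eval-[] t σ ρ)))
    sound v refl          ρ = ≡.refl
    sound v (sym d)       ρ = ≡.sym (sound v d ρ)
    sound v (trans d d′)  ρ = ≡.trans (sound v d ρ) (sound v d′ ρ)
    sound v (¬-cong d)    ρ = ≡.cong ¬ᴬ (sound v d ρ)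
    sound v (∧-cong d d′) ρ = ≡.cong₂ _∧ᴬ_ (sound v d ρ) (sound v d′ ρ)
    sound v (∨-cong d d′) ρ = ≡.cong₂ _∨ᴬ_ (sound v d ρ) (sound v d′ ρ)

    -- Validity quantifies over valuations of infinitely many variables. With three variables it
    -- comes down to finitely many cases, which can be decided.
    Bounded : Term K → Set
    Bounded (var n)   = n < 3
    Bounded (const k) = ⊤
    Bounded (¬ s)     = Bounded s
    Bounded (s ∧ t)   = Bounded s × Bounded t
    Bounded (s ∨ t)   = Bounded s × Bounded t

    bounded? : ∀ s → Dec (Bounded s)
    bounded? (var n)   = n <? 3
    bounded? (const k) = yes tt
    bounded? (¬ s)     = bounded? s
    bounded? (s ∧ t)   = bounded? s ×-dec bounded? t
    bounded? (s ∨ t)   = bounded? s ×-dec bounded? t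

    eval-bounded : ∀ s → Bounded s → ∀ ρ → eval s ρ ≡ eval s (assign (ρ 0) (ρ 1) (ρ 2))
    eval-bounded (var 0)   b       ρ = ≡.refl
    eval-bounded (var 1)   b       ρ = ≡.refl
    eval-bounded (var 2)   b       ρ = ≡.refl
    eval-bounded (var (suc (suc (suc n)))) (s≤s (s≤s (s≤s ()))) ρ
    eval-bounded (const T) b       ρ = ≡.refl
    eval-bounded (const F) b       ρ = ≡.refl
    eval-bounded (const U) b       ρ = ≡.refl
    eval-bounded (¬ s)     b       ρ = ≡.cong ¬ᴬ (eval-bounded s b ρ)
    eval-bounded (s ∧ t)   (b , c) ρ = ≡.cong₂ _∧ᴬ_ (eval-bounded s b ρ) (eval-bounded t c ρ)
    eval-bounded (s ∨ t)   (b , c) ρ = ≡.cong₂ _∨ᴬ_ (eval-bounded s b ρ) (eval-bounded t c ρ)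

    Holds : Equation K → Set
    Holds (s ≈ t) = ∀ a b c → eval s (assign a b c) ≡ eval t (assign a b c)

    holds? : ∀ e → Dec (Holds e)
    holds? (s ≈ t) = all? λ a → all? λ b → all? λ c →
      eval s (assign a b c) ≟ eval t (assign a b c)

    BoundedHolds : Equation K → Set
    BoundedHolds e = (Bounded (Equation.lhs e) × Bounded (Equation.rhs e)) × Holds e

    boundedHolds? : ∀ e → Dec (BoundedHolds e)
    boundedHolds? e = (bounded? (Equation.lhs e) ×-dec bounded? (Equation.rhs e)) ×-dec holds? e

    boundedHolds⇒valid : ∀ e → BoundedHolds e → Valid e
    boundedHolds⇒valid (s ≈ t) ((b , c) , h) ρ =
      ≡.trans (eval-bounded s b ρ) (≡.trans (h (ρ 0) (ρ 1) (ρ 2)) (≡.sym (eval-bounded t c ρ)))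

  separates? : (E : List (Equation K)) (A : Fin (length E) → Algebra) →
    Dec (∀ i → All (BoundedHolds (A i)) (removeAt E i) × not Holds (A i) (lookup E i))
  separates? E A = all? λ i →
    All.all? (boundedHolds? (A i)) (removeAt E i) ×-dec ¬? (holds? (A i) (lookup E i))

  -- The implicit argument is solved by evaluating the decision procedure, so a list of algebras,
  -- one for each axiom, is the whole proof.
  independent : (E : List (Equation K)) (As : Vec Algebra (length E)) →
    {True (separates? E (Vec.lookup As))} → Independent E
  independent E As {separated} i d with holds , fails ← toWitness separated i =
    fails (λ a b c → sound A (All.map (λ {e} → boundedHolds⇒valid A e) holds) d (assign a b c))
    where A = Vec.lookup As i

-- The separating algebras.

open Semantics using (independent)

-- In the three-element algebras 0F, 1F and 2F stand for U, F and T.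
involution₃ : Fin 3 → Fin 3
involution₃ 0F = 0F
involution₃ 1F = 2F
involution₃ 2F = 1F

-- The sequential tables are those of `C`; the others are Kleene's strong three-valued logic, where
-- a decisive second argument overrides an undefined first one.
sequential-∧ sequential-∨ kleene-∧ kleene-∨ : Fin 3 → Fin 3 → Fin 3
sequential-∧ 0F y = 0F
sequential-∧ 1F y = 1F
sequential-∧ 2F y = y
sequential-∨ 0F y = 0F
sequential-∨ 1F y = y
sequential-∨ 2F y = 2F
kleene-∧ 0F 1F = 1F
kleene-∧ 0F y  = 0F
kleene-∧ 1F y  = 1F
kleene-∧ 2F y  = y
kleene-∨ 0F 2F = 2F
kleene-∨ 0F y  = 0F
kleene-∨ 1F y  = y
kleene-∨ 2F y  = 2F

C-with : (t f u : Fin 3) → Algebra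
C-with t f u = record
  { ¬ᴬ = involution₃ ; _∧ᴬ_ = sequential-∧ ; _∨ᴬ_ = sequential-∨ ; Tᴬ = t ; Fᴬ = f ; Uᴬ = u }

-- The first three keep the tables of `C` and change only the constants: `F` is read as true, all
-- constants as undefined, and `U` as true, respectively.
neg-fails tand-fails und-fails dneg-fails or-fails abs-fails mem-fails com-fails : Algebra
neg-fails  = C-with 2F 2F 0F
tand-fails = C-with 0F 0F 0F
und-fails  = C-with 2F 1F 2F
-- Negation and join are constantly `1F`, so both sides of Or, Mem and Com are `1F`, while `0F` is
-- not a double negation.
dneg-fails = record
  { size = 2 ; ¬ᴬ = λ _ → 1F ; _∧ᴬ_ = λ x _ → x ; _∨ᴬ_ = λ _ _ → 1F
  ; Tᴬ = 1F ; Fᴬ = 1F ; Uᴬ = 1F }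
-- The meet is altered at an undefined first argument only, and the join is no longer its De Morgan
-- dual.
or-fails   = record
  { ¬ᴬ = involution₃ ; _∧ᴬ_ = almost-sequential-∧ ; _∨ᴬ_ = sequential-∨
  ; Tᴬ = 2F ; Fᴬ = 1F ; Uᴬ = 0F }
  where
  almost-sequential-∧ : Fin 3 → Fin 3 → Fin 3
  almost-sequential-∧ 0F 0F = 0F
  almost-sequential-∧ 0F y  = 1F
  almost-sequential-∧ x  y  = sequential-∧ x y
-- A two-element semilattice with identity negation: both operations are the same join, so `0F`
-- fails to absorb `1F`.
abs-fails  = record
  { ¬ᴬ = λ x → x ; _∧ᴬ_ = join ; _∨ᴬ_ = join ; Tᴬ = 0F ; Fᴬ = 0F ; Uᴬ = 0F }
  where
  join : Fin 2 → Fin 2 → Fin 2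
  join 0F y = y
  join 1F y = 1F
-- Mem fails with `x` undefined and `y`, `z` true: the left-hand side is true, whereas both
-- disjuncts on the right are undefined.
mem-fails  = record
  { ¬ᴬ = involution₃ ; _∧ᴬ_ = kleene-∧ ; _∨ᴬ_ = kleene-∨ ; Tᴬ = 2F ; Fᴬ = 1F ; Uᴬ = 0F }
-- 3F is a second undefined value.
com-fails  = record
  { ¬ᴬ = neg ; _∧ᴬ_ = and ; _∨ᴬ_ = or ; Tᴬ = 2F ; Fᴬ = 1F ; Uᴬ = 0F }
  where
  neg : Fin 4 → Fin 4
  neg 0F = 0F
  neg 1F = 2F
  neg 2F = 1F
  neg 3F = 3F

  and or : Fin 4 → Fin 4 → Fin 4
  and 2F y = y
  and x  y = x
  or  1F y = y
  or  x  y = x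

theorem5p2 : (Ax₀ CompletelyAxiomatises CL₀ × Independent Ax₀)
    × (Ax₂ CompletelyAxiomatises CL₂ × Independent Ax₂)
    × (Axᵁ CompletelyAxiomatises CLᵁ × Independent Axᵁ)
    × (Ax₃ CompletelyAxiomatises CL₃ × Independent Ax₃)
theorem5p2 =
    (Ax₀-complete , independent Ax₀
      (dneg-fails ∷ or-fails ∷ abs-fails ∷ mem-fails ∷ com-fails ∷ []))
  , (Ax₂-complete , independent Ax₂
      (neg-fails ∷ or-fails ∷ tand-fails ∷ abs-fails ∷ mem-fails ∷ com-fails ∷ []))
  , (Axᵁ-complete , independent Axᵁ
      (dneg-fails ∷ und-fails ∷ or-fails ∷ abs-fails ∷ mem-fails ∷ com-fails ∷ []))
  , (Ax₃-complete , independent Ax₃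
      (neg-fails ∷ or-fails ∷ tand-fails ∷ abs-fails ∷ mem-fails ∷ com-fails ∷ und-fails ∷ []))
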